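{- Let $p$ be a prime and $K$ a finite extension of $\mathbb{Q}_p$. Suppose that $B$ is a nonempty finite set of elements of $K$ such that $|\beta|_p<1$ for each $\beta\in B$. For each $\beta\in B$ let $c_\beta:\mathbb{Z}_p\to K$ be a continuous function, and for $n\in\mathbb N$ define $s(n)=\sum_{\beta\in B}c_\beta(n)\beta^n$. If there is a twisted interpolation of $s(n)_{n\ge0}$ to $\mathbb{Z}_p$, then $s(n)=0$ for all $n\ge 0$.
   Context: $\mathbb N=\{0,1,2,\dots\}$; $|\cdot|_p$ is the unique absolute value on $K$ extending the $p$-adic one. Let $q\ge1$ be a power of $p$. A twisted interpolation of $s(n)_{n\ge0}$ to $\mathbb{Z}_p$ is a family $\{(s_j,A_j):j\in J\}$ where $\mathbb N=\bigcup_{j\in J}A_j$ is a finite partition with each $A_j$ dense in $r+q\mathbb{Z}_p$ for some $0\le r\le q-1$, $L$ is a finite extension of $\mathbb{Q}_p$, each $s_j:\mathbb{Z}_p\to L$ is continuous, and $s(n)=s_j(n)$ for all $n\in A_j$ and $j\in J$. -}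

module Defs where

open import Algebra.Apartness.Bundles using (HeytingField; module HeytingCommutativeRing)
open import Algebra.Bundles using (CommutativeRing)
open import Algebra.Morphism.Structures using (module RingMorphisms)
import Algebra.Properties.Monoid.Sum as MonoidSum
import Algebra.Properties.Semiring.Exp as SemiringExp
open import Data.Fin.Base using (Fin)
open import Data.Integer.Base as ℤ using (+_)
import Data.Integer.Properties as ℤ
import Data.Integer.Divisibility.Signed as ℤ∣
open import Data.Nat.Base as ℕ using (ℕ; zero; suc)
import Data.Nat.Properties as ℕ
import Data.Nat.Divisibility as ℕ∣
open import Data.Nat.Primality using (Prime; prime⇒nonZero; prime⇒nonTrivial; euclidsLemma)
open import Data.Product.Base using (Σ; ∃-syntax; _×_; _,_; proj₁)
open import Data.Rational.Base as ℚ using (ℚ; 0ℚ; 1ℚ; ½; mkℚ; ↥_; ↧_; ↧ₙ_)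
import Data.Rational.Properties as ℚ
import Data.Rational.Unnormalised.Base as ℚᵘ
import Data.Rational.Unnormalised.Properties as ℚᵘ
open import Data.Rational.Solver using (module +-*-Solver)
open import Data.Sum.Base using (inj₁; inj₂; [_,_]′)
open import Level using (Level; 0ℓ) renaming (suc to lsuc)
open import Relation.Binary.PropositionalEquality using (_≡_; refl; sym; trans; cong; cong₂; subst; subst₂)
open import Relation.Nullary using (yes; no; contradiction)
open import Relation.Unary using (Pred; _∈_)

record AbsoluteValueℚ : Set where
  field
    ∣_∣      : ℚ → ℚ
    0≤∣∣     : ∀ x → 0ℚ ℚ.≤ ∣ x ∣
    ∣0∣      : ∣ 0ℚ ∣ ≡ 0ℚ
    definite : ∀ x → ∣ x ∣ ≡ 0ℚ → x ≡ 0ℚ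
    ∣-∣      : ∀ x → ∣ ℚ.- x ∣ ≡ ∣ x ∣
    ∣*∣      : ∀ x y → ∣ x ℚ.* y ∣ ≡ ∣ x ∣ ℚ.* ∣ y ∣
    triangle : ∀ x y → ∣ x ℚ.+ y ∣ ℚ.≤ ∣ x ∣ ℚ.+ ∣ y ∣

-- The completion of ℚ at an absolute value: Cauchy sequences, with null
-- sequences identified through the setoid equality _≈_.
module Completion (V : AbsoluteValueℚ) where
  open AbsoluteValueℚ V
  open +-*-Solver

  infix  4 _≈_
  infixl 6 _+_
  infixl 7 _*_
  infix  8 -_

  record Carrier : Set where
    constructor mk
    field
      seq    : ℕ → ℚ
      cauchy : ∀ ε → 0ℚ ℚ.< ε → ∃[ N ] ∀ m n → N ℕ.≤ m → N ℕ.≤ n →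
               ∣ seq m ℚ.- seq n ∣ ℚ.< ε

  open Carrier public

  _≈_ : Carrier → Carrier → Set
  x ≈ y = ∀ ε → 0ℚ ℚ.< ε → ∃[ N ] ∀ n → N ℕ.≤ n → ∣ seq x n ℚ.- seq y n ∣ ℚ.< ε

  ½*pos : ∀ {ε} → 0ℚ ℚ.< ε → 0ℚ ℚ.< ½ ℚ.* ε
  ½*pos {ε} 0<ε = subst (ℚ._< ½ ℚ.* ε) (ℚ.*-zeroʳ ½) (ℚ.*-monoʳ-<-pos ½ 0<ε)

  halves : ∀ ε → ½ ℚ.* ε ℚ.+ ½ ℚ.* ε ≡ ε
  halves ε = trans (sym (ℚ.*-distribʳ-+ ε ½ ½)) (ℚ.*-identityˡ ε)

  ∣∣-comm : ∀ a b → ∣ a ℚ.- b ∣ ≡ ∣ b ℚ.- a ∣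
  ∣∣-comm a b = trans (cong ∣_∣ (solve 2 (λ a b → a :- b := :- (b :- a)) refl a b)) (∣-∣ _)

  sum<ε : ∀ {ε a b u v} → a ℚ.≤ u ℚ.+ v → u ℚ.< ½ ℚ.* ε → v ℚ.< ½ ℚ.* ε → b ≡ a → b ℚ.< ε
  sum<ε {ε} le u< v< refl =
    ℚ.≤-<-trans le (subst (_ ℚ.<_) (halves ε) (ℚ.+-mono-< u< v<))

  zero<ε : ∀ {ε a} → 0ℚ ℚ.< ε → a ≡ 0ℚ → ∣ a ∣ ℚ.< ε
  zero<ε {ε} 0<ε refl = subst (ℚ._< ε) (sym ∣0∣) 0<ε

  share : ∀ ε A → 0ℚ ℚ.< ε → 0ℚ ℚ.< A → ∃[ δ ] 0ℚ ℚ.< δ × A ℚ.* δ ≡ ½ ℚ.* ε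
  share ε A 0<ε 0<A = δ , 0<δ , A*δ
    where
    instance
      pA : ℚ.Positive A
      pA = ℚ.positive 0<A
      nzA : ℚ.NonZero A
      nzA = ℚ.pos⇒nonZero A
      p1/A : ℚ.Positive (ℚ.1/ A)
      p1/A = ℚ.1/pos⇒pos A
    δ : ℚ
    δ = (ℚ.1/ A) ℚ.* (½ ℚ.* ε)
    0<δ : 0ℚ ℚ.< δ
    0<δ = subst (ℚ._< δ) (ℚ.*-zeroʳ (ℚ.1/ A)) (ℚ.*-monoʳ-<-pos (ℚ.1/ A) (½*pos 0<ε))
    A*δ : A ℚ.* δ ≡ ½ ℚ.* ε
    A*δ = trans (sym (ℚ.*-assoc A (ℚ.1/ A) _))
            (trans (cong (ℚ._* (½ ℚ.* ε)) (ℚ.*-inverseʳ A)) (ℚ.*-identityˡ _))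

  bounded : (x : Carrier) → ∃[ B ] 0ℚ ℚ.< B × ∃[ N ] ∀ n → N ℕ.≤ n → ∣ seq x n ∣ ℚ.≤ B
  bounded x with cauchy x 1ℚ (ℚ.positive⁻¹ 1ℚ)
  ... | N , c = ∣ seq x N ∣ ℚ.+ 1ℚ
              , ℚ.+-mono-≤-< (0≤∣∣ (seq x N)) (ℚ.positive⁻¹ 1ℚ)
              , N , λ n N≤n → subst (ℚ._≤ ∣ seq x N ∣ ℚ.+ 1ℚ)
                  (cong ∣_∣ (solve 2 (λ a b → a :+ (b :- a) := b) refl (seq x N) (seq x n)))
                  (ℚ.≤-trans (triangle (seq x N) (seq x n ℚ.- seq x N))
                    (ℚ.+-monoʳ-≤ ∣ seq x N ∣ (ℚ.<⇒≤ (c n N N≤n ℕ.≤-refl))))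

  mul<ε : ∀ {ε a a′ b b′ A B α β} → 0ℚ ℚ.< A → 0ℚ ℚ.< B →
          ∣ a ∣ ℚ.≤ A → ∣ b′ ∣ ℚ.≤ B → A ℚ.* β ≡ ½ ℚ.* ε → B ℚ.* α ≡ ½ ℚ.* ε →
          ∣ a ℚ.- a′ ∣ ℚ.< α → ∣ b ℚ.- b′ ∣ ℚ.< β → ∣ a ℚ.* b ℚ.- a′ ℚ.* b′ ∣ ℚ.< ε
  mul<ε {ε} {a} {a′} {b} {b′} {A} {B} {α} {β} 0<A 0<B a≤A b≤B Aβ Bα a< b< =
    sum<ε (triangle (a ℚ.* (b ℚ.- b′)) (b′ ℚ.* (a ℚ.- a′)))
      (factor 0<A a≤A Aβ b<) (factor 0<B b≤B Bα a<)
      (cong ∣_∣ (solve 4 (λ a a′ b b′ →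
        a :* b :- a′ :* b′ := a :* (b :- b′) :+ b′ :* (a :- a′)) refl a a′ b b′))
    where
    factor : ∀ {u d C γ} → 0ℚ ℚ.< C → ∣ u ∣ ℚ.≤ C → C ℚ.* γ ≡ ½ ℚ.* ε →
             ∣ d ∣ ℚ.< γ → ∣ u ℚ.* d ∣ ℚ.< ½ ℚ.* ε
    factor {u} {d} {C} {γ} 0<C u≤C Cγ d< = subst₂ ℚ._<_ (sym (∣*∣ u d)) Cγ
      (ℚ.≤-<-trans
        (ℚ.*-monoʳ-≤-nonNeg ∣ d ∣ {{ℚ.nonNegative (0≤∣∣ d)}} u≤C)
        (ℚ.*-monoʳ-<-pos C {{ℚ.positive 0<C}} d<))

  ⊔₁ : ∀ {a b n} → a ℕ.⊔ b ℕ.≤ n → a ℕ.≤ n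
  ⊔₁ {a} {b} = ℕ.m⊔n≤o⇒m≤o a b
  ⊔₂ : ∀ {a b n} → a ℕ.⊔ b ℕ.≤ n → b ℕ.≤ n
  ⊔₂ {a} {b} = ℕ.m⊔n≤o⇒n≤o a b

  fromℚ : ℚ → Carrier
  fromℚ a = mk (λ _ → a) λ ε 0<ε → 0 , λ _ _ _ _ → zero<ε 0<ε (ℚ.+-inverseʳ a)

  _+_ : Carrier → Carrier → Carrier
  x + y = mk (λ n → seq x n ℚ.+ seq y n) λ ε 0<ε →
    let N , c = cauchy x (½ ℚ.* ε) (½*pos 0<ε)
        M , d = cauchy y (½ ℚ.* ε) (½*pos 0<ε)
    in N ℕ.⊔ M , λ m n p q →
       sum<ε (triangle _ _) (c m n (⊔₁ p) (⊔₁ q)) (d m n (⊔₂ {N} p) (⊔₂ {N} q))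
         (cong ∣_∣ (solve 4 (λ a b c d → a :+ b :- (c :+ d) := (a :- c) :+ (b :- d)) refl
           (seq x m) (seq y m) (seq x n) (seq y n)))

  -_ : Carrier → Carrier
  - x = mk (λ n → ℚ.- seq x n) λ ε 0<ε →
    let N , c = cauchy x ε 0<ε
    in N , λ m n p q → subst (ℚ._< ε)
         (cong ∣_∣ (solve 2 (λ a b → b :- a := :- a :- (:- b)) refl (seq x m) (seq x n)))
         (c n m q p)

  _*_ : Carrier → Carrier → Carrier
  x * y = mk (λ n → seq x n ℚ.* seq y n) λ ε 0<ε →
    let A , 0<A , N₁ , x≤A = bounded x
        B , 0<B , N₂ , y≤B = bounded y
        β , 0<β , Aβ = share ε A 0<ε 0<A
        α , 0<α , Bα = share ε B 0<ε 0<B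
        N₃ , c = cauchy x α 0<α
        N₄ , d = cauchy y β 0<β
    in (N₁ ℕ.⊔ N₂) ℕ.⊔ (N₃ ℕ.⊔ N₄) , λ m n p q →
       mul<ε 0<A 0<B (x≤A m (⊔₁ {N₁} (⊔₁ p))) (y≤B n (⊔₂ {N₁} (⊔₁ q))) Aβ Bα
         (c m n (⊔₁ {N₃} (⊔₂ {N₁ ℕ.⊔ N₂} p)) (⊔₁ {N₃} (⊔₂ {N₁ ℕ.⊔ N₂} q)))
         (d m n (⊔₂ {N₃} (⊔₂ {N₁ ℕ.⊔ N₂} p)) (⊔₂ {N₃} (⊔₂ {N₁ ℕ.⊔ N₂} q)))

  pointwise : ∀ {x y} → (∀ n → seq x n ≡ seq y n) → x ≈ y
  pointwise {x} {y} eq ε 0<ε = 0 , λ n _ →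
    zero<ε 0<ε (trans (cong (ℚ._- seq y n) (eq n)) (ℚ.+-inverseʳ (seq y n)))

  ≈-sym : ∀ {x y} → x ≈ y → y ≈ x
  ≈-sym {x} {y} e ε 0<ε with e ε 0<ε
  ... | N , c = N , λ n p → subst (ℚ._< ε) (∣∣-comm (seq x n) (seq y n)) (c n p)

  ≈-trans : ∀ {x y z} → x ≈ y → y ≈ z → x ≈ z
  ≈-trans {x} {y} {z} e f ε 0<ε =
    let N , c = e (½ ℚ.* ε) (½*pos 0<ε)
        M , d = f (½ ℚ.* ε) (½*pos 0<ε)
    in N ℕ.⊔ M , λ n p → sum<ε (triangle _ _) (c n (⊔₁ p)) (d n (⊔₂ {N} p))
         (cong ∣_∣ (solve 3 (λ a b c → a :- c := (a :- b) :+ (b :- c)) refl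
           (seq x n) (seq y n) (seq z n)))

  +-cong : ∀ {x x′ y y′} → x ≈ x′ → y ≈ y′ → x + y ≈ x′ + y′
  +-cong {x} {x′} {y} {y′} e f ε 0<ε =
    let N , c = e (½ ℚ.* ε) (½*pos 0<ε)
        M , d = f (½ ℚ.* ε) (½*pos 0<ε)
    in N ℕ.⊔ M , λ n p → sum<ε (triangle _ _) (c n (⊔₁ p)) (d n (⊔₂ {N} p))
         (cong ∣_∣ (solve 4 (λ a b c d → a :+ b :- (c :+ d) := (a :- c) :+ (b :- d)) refl
           (seq x n) (seq y n) (seq x′ n) (seq y′ n)))

  -‿cong : ∀ {x y} → x ≈ y → - x ≈ - y
  -‿cong {x} {y} e ε 0<ε =
    let N , c = ≈-sym {x} {y} e ε 0<ε
    in N , λ n p → subst (ℚ._< ε)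
         (cong ∣_∣ (solve 2 (λ a b → b :- a := :- a :- (:- b)) refl (seq x n) (seq y n)))
         (c n p)

  *-cong : ∀ {x x′ y y′} → x ≈ x′ → y ≈ y′ → x * y ≈ x′ * y′
  *-cong {x} {x′} {y} {y′} e f ε 0<ε =
    let A , 0<A , N₁ , x≤A = bounded x
        B , 0<B , N₂ , y≤B = bounded y′
        β , 0<β , Aβ = share ε A 0<ε 0<A
        α , 0<α , Bα = share ε B 0<ε 0<B
        N₃ , c = e α 0<α
        N₄ , d = f β 0<β
    in (N₁ ℕ.⊔ N₂) ℕ.⊔ (N₃ ℕ.⊔ N₄) , λ n p →
       mul<ε 0<A 0<B (x≤A n (⊔₁ {N₁} (⊔₁ p))) (y≤B n (⊔₂ {N₁} (⊔₁ p))) Aβ Bα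
         (c n (⊔₁ {N₃} (⊔₂ {N₁ ℕ.⊔ N₂} p)))
         (d n (⊔₂ {N₃} (⊔₂ {N₁ ℕ.⊔ N₂} p)))

  commutativeRing : CommutativeRing 0ℓ 0ℓ
  commutativeRing = record
    { Carrier = Carrier ; _≈_ = _≈_ ; _+_ = _+_ ; _*_ = _*_ ; -_ = -_
    ; 0# = fromℚ 0ℚ ; 1# = fromℚ 1ℚ
    ; isCommutativeRing = record
      { isRing = record
        { +-isAbelianGroup = record
          { isGroup = record
            { isMonoid = record
              { isSemigroup = record
                { isMagma = record
                  { isEquivalence = record
                    { refl  = λ {x} → pointwise {x} {x} λ _ → refl
                    ; sym   = λ {x} {y} → ≈-sym {x} {y}
                    ; trans = λ {x} {y} {z} → ≈-trans {x} {y} {z}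
                    }
                  ; ∙-cong = λ {x} {x′} {y} {y′} → +-cong {x} {x′} {y} {y′}
                  }
                ; assoc = λ x y z → pointwise {(x + y) + z} {x + (y + z)}
                    λ n → ℚ.+-assoc (seq x n) (seq y n) (seq z n)
                }
              ; identity = (λ x → pointwise {fromℚ 0ℚ + x} {x} λ n → ℚ.+-identityˡ (seq x n))
                         , (λ x → pointwise {x + fromℚ 0ℚ} {x} λ n → ℚ.+-identityʳ (seq x n))
              }
            ; inverse = (λ x → pointwise {(- x) + x} {fromℚ 0ℚ} λ n → ℚ.+-inverseˡ (seq x n))
                      , (λ x → pointwise {x + (- x)} {fromℚ 0ℚ} λ n → ℚ.+-inverseʳ (seq x n))
            ; ⁻¹-cong = λ {x} {y} → -‿cong {x} {y}
            }
          ; comm = λ x y → pointwise {x + y} {y + x} λ n → ℚ.+-comm (seq x n) (seq y n)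
          }
        ; *-cong = λ {x} {x′} {y} {y′} → *-cong {x} {x′} {y} {y′}
        ; *-assoc = λ x y z → pointwise {(x * y) * z} {x * (y * z)}
            λ n → ℚ.*-assoc (seq x n) (seq y n) (seq z n)
        ; *-identity = (λ x → pointwise {fromℚ 1ℚ * x} {x} λ n → ℚ.*-identityˡ (seq x n))
                     , (λ x → pointwise {x * fromℚ 1ℚ} {x} λ n → ℚ.*-identityʳ (seq x n))
        ; distrib = (λ x y z → pointwise {x * (y + z)} {x * y + x * z}
                      λ n → ℚ.*-distribˡ-+ (seq x n) (seq y n) (seq z n))
                  , (λ x y z → pointwise {(y + z) * x} {y * x + z * x}
                      λ n → ℚ.*-distribʳ-+ (seq x n) (seq y n) (seq z n))
        }
      ; *-comm = λ x y → pointwise {x * y} {y * x} λ n → ℚ.*-comm (seq x n) (seq y n)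
      }
    }

archimedean : AbsoluteValueℚ
archimedean = record
  { ∣_∣      = ℚ.∣_∣
  ; 0≤∣∣     = ℚ.0≤∣p∣
  ; ∣0∣      = refl
  ; definite = ℚ.∣p∣≡0⇒p≡0
  ; ∣-∣      = ℚ.∣-p∣≡∣p∣
  ; ∣*∣      = ℚ.∣p*q∣≡∣p∣*∣q∣
  ; triangle = ℚ.∣p+q∣≤∣p∣+∣q∣
  }

module Real where
  open Completion archimedean public

  infix 4 _<_ _≤_

  0ℝ 1ℝ : Carrier
  0ℝ = fromℚ 0ℚ
  1ℝ = fromℚ 1ℚ

  _<_ : Carrier → Carrier → Set
  x < y = ∃[ ε ] 0ℚ ℚ.< ε × ∃[ N ] ∀ n → N ℕ.≤ n → seq x n ℚ.+ ε ℚ.≤ seq y n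

  _≤_ : Carrier → Carrier → Set
  x ≤ y = ∀ ε → 0ℚ ℚ.< ε → ∃[ N ] ∀ n → N ℕ.≤ n → seq x n ℚ.≤ seq y n ℚ.+ ε

ℝ : Set
ℝ = Real.Carrier

-- The continuous extension of an absolute value on ℚ to the completion.
module _ (V : AbsoluteValueℚ) where
  open AbsoluteValueℚ V
  open Completion V using (Carrier; mk; seq; cauchy)
  open +-*-Solver

  private
    reverse : ∀ a b → ∣ a ∣ ℚ.- ∣ b ∣ ℚ.≤ ∣ a ℚ.- b ∣
    reverse a b = subst (∣ a ∣ ℚ.- ∣ b ∣ ℚ.≤_)
      (solve 2 (λ d b → (d :+ b) :- b := d) refl ∣ a ℚ.- b ∣ ∣ b ∣)
      (ℚ.+-monoˡ-≤ (ℚ.- ∣ b ∣)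
        (subst (λ t → ∣ t ∣ ℚ.≤ ∣ a ℚ.- b ∣ ℚ.+ ∣ b ∣)
          (solve 2 (λ a b → (a :- b) :+ b := a) refl a b) (triangle (a ℚ.- b) b)))

    reverse′ : ∀ a b → ℚ.- (∣ a ∣ ℚ.- ∣ b ∣) ℚ.≤ ∣ a ℚ.- b ∣
    reverse′ a b = subst₂ ℚ._≤_
      (solve 2 (λ a b → b :- a := :- (a :- b)) refl ∣ a ∣ ∣ b ∣)
      (trans (cong ∣_∣ (solve 2 (λ a b → b :- a := :- (a :- b)) refl a b)) (∣-∣ _))
      (reverse b a)

    reverse-abs : ∀ a b → ℚ.∣ ∣ a ∣ ℚ.- ∣ b ∣ ∣ ℚ.≤ ∣ a ℚ.- b ∣
    reverse-abs a b with ℚ.∣p∣≡p∨∣p∣≡-p (∣ a ∣ ℚ.- ∣ b ∣)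
    ... | inj₁ e = subst (ℚ._≤ ∣ a ℚ.- b ∣) (sym e) (reverse a b)
    ... | inj₂ e = subst (ℚ._≤ ∣ a ℚ.- b ∣) (sym e) (reverse′ a b)

  extendedAbs : Carrier → ℝ
  extendedAbs x = Real.mk (λ n → ∣ seq x n ∣) λ ε 0<ε →
    let N , c = cauchy x ε 0<ε
    in N , λ m n p q → ℚ.≤-<-trans (reverse-abs (seq x m) (seq x n)) (c m n p q)

module PAdic (p : ℕ) (p-prime : Prime p) where

  private
    instance
      p≢0 : ℕ.NonZero p
      p≢0 = prime⇒nonZero p-prime

    1<p : 1 ℕ.< p
    1<p = ℕ.nonTrivial⇒n>1 p {{prime⇒nonTrivial p-prime}}

    instance
      posP : ℚ.Positive (+ p ℚ./ 1)
      posP = ℚ.normalize-pos p 1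
      nzP : ℚ.NonZero (+ p ℚ./ 1)
      nzP = ℚ.pos⇒nonZero (+ p ℚ./ 1)
      posP⁻¹ : ℚ.Positive (ℚ.1/ (+ p ℚ./ 1))
      posP⁻¹ = ℚ.1/pos⇒pos (+ p ℚ./ 1)

  open SemiringExp (CommutativeRing.semiring ℚ.+-*-commutativeRing) using (_^_; ^-homo-*)

  p^ : ℕ → ℚ
  p^ k = (+ p ℚ./ 1) ^ k

  p^- : ℕ → ℚ
  p^- k = (ℚ.1/ (+ p ℚ./ 1)) ^ k

  -- The largest k ≤ b with p ^ k ∣ n.
  maxExponent : (b n : ℕ) → ℕ
  maxExponent zero    n = 0
  maxExponent (suc b) n with p ℕ.^ suc b ℕ∣.∣? n
  ... | yes _ = suc b
  ... | no  _ = maxExponent b n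

  -- The p-adic valuation of n > 0; the search bound n is harmless as n < p ^ n.
  ν : ℕ → ℕ
  ν n = maxExponent n n

  ∣_∣ℕ : ℕ → ℚ
  ∣ zero  ∣ℕ = 0ℚ
  ∣ suc n ∣ℕ = p^- (ν (suc n))

  ∣_∣ₚ : ℚ → ℚ
  ∣ x ∣ₚ = ∣ ℤ.∣ ↥ x ∣ ∣ℕ ℚ.* p^ (ν (↧ₙ x))

  k<p^k : ∀ k → k ℕ.< p ℕ.^ k
  k<p^k zero    = ℕ.≤-refl
  k<p^k (suc k) = ℕ.≤-<-trans (k<p^k k) (ℕ.^-monoʳ-< p 1<p (ℕ.n<1+n k))

  p^maxExponent∣ : ∀ b n → p ℕ.^ maxExponent b n ℕ∣.∣ n
  p^maxExponent∣ zero    n = ℕ∣.1∣ n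
  p^maxExponent∣ (suc b) n with p ℕ.^ suc b ℕ∣.∣? n
  ... | yes d = d
  ... | no  _ = p^maxExponent∣ b n

  ≤maxExponent : ∀ b n k → k ℕ.≤ b → p ℕ.^ k ℕ∣.∣ n → k ℕ.≤ maxExponent b n
  ≤maxExponent zero    n k k≤b d = k≤b
  ≤maxExponent (suc b) n k k≤b d with p ℕ.^ suc b ℕ∣.∣? n
  ... | yes _ = k≤b
  ... | no ¬d with ℕ.m≤n⇒m<n∨m≡n k≤b
  ...   | inj₁ k<sb = ≤maxExponent b n k (ℕ.≤-pred k<sb) d
  ...   | inj₂ refl = contradiction d ¬d

  p^ν∣ : ∀ n → p ℕ.^ ν n ℕ∣.∣ n
  p^ν∣ n = p^maxExponent∣ n n

  ≤ν : ∀ n .{{_ : ℕ.NonZero n}} k → p ℕ.^ k ℕ∣.∣ n → k ℕ.≤ ν n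
  ≤ν n k d = ≤maxExponent n n k (ℕ.<⇒≤ (ℕ.<-≤-trans (k<p^k k) (ℕ∣.∣⇒≤ d))) d

  p^*p^- : ∀ k → p^ k ℚ.* p^- k ≡ 1ℚ
  p^*p^- zero    = refl
  p^*p^- (suc k) = trans
    (solve 4 (λ a b c d → (a :* b) :* (c :* d) := (a :* c) :* (b :* d)) refl
      (+ p ℚ./ 1) (p^ k) (ℚ.1/ (+ p ℚ./ 1)) (p^- k))
    (trans (cong₂ ℚ._*_ (ℚ.*-inverseʳ (+ p ℚ./ 1)) (p^*p^- k)) (ℚ.*-identityˡ 1ℚ))
    where open +-*-Solver

  ^-pos : ∀ x .{{_ : ℚ.Positive x}} k → ℚ.Positive (x ^ k)
  ^-pos x zero    = _
  ^-pos x (suc k) = ℚ.pos*pos⇒pos x (x ^ k) {{^-pos x k}}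

  p^-pos : ∀ k → ℚ.Positive (p^- k)
  p^-pos = ^-pos (ℚ.1/ (+ p ℚ./ 1))

  1≤p : 1ℚ ℚ.≤ + p ℚ./ 1
  1≤p = ℚ.toℚᵘ-cancel-≤ (ℚᵘ.≤-trans
    (ℚᵘ.*≤* (subst (+ 1 ℤ.≤_) (sym (ℤ.*-identityʳ (+ p))) (ℤ.+≤+ (ℕ.<⇒≤ 1<p))))
    (ℚᵘ.≤-reflexive (ℚᵘ.≃-sym (ℚ.toℚᵘ-fromℚᵘ (ℚᵘ.mkℚᵘ (+ p) 0)))))

  p⁻¹≤1 : ℚ.1/ (+ p ℚ./ 1) ℚ.≤ 1ℚ
  p⁻¹≤1 = subst₂ ℚ._≤_ (ℚ.*-identityʳ _) (ℚ.*-inverseˡ (+ p ℚ./ 1))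
    (ℚ.*-monoˡ-≤-nonNeg (ℚ.1/ (+ p ℚ./ 1)) {{ℚ.pos⇒nonNeg (ℚ.1/ (+ p ℚ./ 1))}} 1≤p)

  p^-≤1 : ∀ k → p^- k ℚ.≤ 1ℚ
  p^-≤1 zero    = ℚ.≤-refl
  p^-≤1 (suc k) = ℚ.≤-trans
    (ℚ.*-monoʳ-≤-nonNeg (p^- k) {{ℚ.pos⇒nonNeg (p^- k) {{p^-pos k}}}} p⁻¹≤1)
    (subst (ℚ._≤ 1ℚ) (sym (ℚ.*-identityˡ (p^- k))) (p^-≤1 k))

  p^-anti : ∀ {j k} → j ℕ.≤ k → p^- k ℚ.≤ p^- j
  p^-anti {j} {k} j≤k = subst₂ ℚ._≤_
    (trans (sym (^-homo-* (ℚ.1/ (+ p ℚ./ 1)) j (k ℕ.∸ j))) (cong p^- (ℕ.m+[n∸m]≡n j≤k)))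
    (ℚ.*-identityʳ (p^- j))
    (ℚ.*-monoˡ-≤-nonNeg (p^- j) {{ℚ.pos⇒nonNeg (p^- j) {{p^-pos j}}}} (p^-≤1 (k ℕ.∸ j)))

  ∣∣ℕ-nonZero : ∀ n .{{_ : ℕ.NonZero n}} → ∣ n ∣ℕ ≡ p^- (ν n)
  ∣∣ℕ-nonZero (suc n) = refl

  0≤∣∣ℕ : ∀ n → 0ℚ ℚ.≤ ∣ n ∣ℕ
  0≤∣∣ℕ zero    = ℚ.≤-refl
  0≤∣∣ℕ (suc n) = ℚ.<⇒≤ (ℚ.positive⁻¹ _ {{p^-pos (ν (suc n))}})

  ν-*-≤ : ∀ m n .{{_ : ℕ.NonZero m}} .{{_ : ℕ.NonZero n}} → ν (m ℕ.* n) ℕ.≤ ν m ℕ.+ ν n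
  ν-*-≤ m n with p^ν∣ m | p^ν∣ n
  ... | ℕ∣.divides a m≡ | ℕ∣.divides b n≡ = ℕ.≮⇒≥ λ lt →
    let instance _ = ℕ.m^n≢0 p (ν m ℕ.+ ν n)
        big : p ℕ.^ suc (ν m ℕ.+ ν n) ℕ∣.∣ m ℕ.* n
        big = ℕ∣.∣-trans (^∣^ lt) (p^ν∣ (m ℕ.* n))
        eq : m ℕ.* n ≡ (a ℕ.* b) ℕ.* p ℕ.^ (ν m ℕ.+ ν n)
        eq = trans (cong₂ ℕ._*_ m≡ n≡) (trans
               (ℕ.[m*n]*[o*p]≡[m*o]*[n*p] a (p ℕ.^ ν m) b (p ℕ.^ ν n))
               (cong ((a ℕ.* b) ℕ.*_) (sym (ℕ.^-distribˡ-+-* p (ν m) (ν n)))))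
        p∣ab : p ℕ∣.∣ a ℕ.* b
        p∣ab = ℕ∣.*-cancelʳ-∣ (p ℕ.^ (ν m ℕ.+ ν n)) (subst (p ℕ.^ suc (ν m ℕ.+ ν n) ℕ∣.∣_) eq big)
    in [ absurd m a m≡ , absurd n b n≡ ]′ (euclidsLemma a b p-prime p∣ab)
    where
    open import Data.Empty using (⊥)
    ^∣^ : ∀ {j k} → j ℕ.≤ k → p ℕ.^ j ℕ∣.∣ p ℕ.^ k
    ^∣^ {j} {k} j≤k = subst (p ℕ.^ j ℕ∣.∣_)
      (trans (sym (ℕ.^-distribˡ-+-* p j (k ℕ.∸ j))) (cong (p ℕ.^_) (ℕ.m+[n∸m]≡n j≤k)))
      (ℕ∣.m∣m*n (p ℕ.^ (k ℕ.∸ j)))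
    absurd : ∀ m .{{_ : ℕ.NonZero m}} a → m ≡ a ℕ.* p ℕ.^ ν m → p ℕ∣.∣ a → ⊥
    absurd m a m≡ p∣a = ℕ.1+n≰n (≤ν m (suc (ν m))
      (subst (p ℕ.^ suc (ν m) ℕ∣.∣_) (sym m≡) (ℕ∣.*-monoˡ-∣ (p ℕ.^ ν m) p∣a)))

  ν-* : ∀ m n .{{_ : ℕ.NonZero m}} .{{_ : ℕ.NonZero n}} → ν (m ℕ.* n) ≡ ν m ℕ.+ ν n
  ν-* m n = ℕ.≤-antisym (ν-*-≤ m n)
    (≤ν (m ℕ.* n) {{ℕ.m*n≢0 m n}} (ν m ℕ.+ ν n)
      (subst (ℕ∣._∣ m ℕ.* n) (sym (ℕ.^-distribˡ-+-* p (ν m) (ν n)))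
        (ℕ∣.*-pres-∣ (p^ν∣ m) (p^ν∣ n))))

  ∣∣ℕ-* : ∀ m n → ∣ m ℕ.* n ∣ℕ ≡ ∣ m ∣ℕ ℚ.* ∣ n ∣ℕ
  ∣∣ℕ-* zero n = sym (ℚ.*-zeroˡ ∣ n ∣ℕ)
  ∣∣ℕ-* m@(suc _) zero = trans (cong ∣_∣ℕ (ℕ.*-zeroʳ m)) (sym (ℚ.*-zeroʳ ∣ m ∣ℕ))
  ∣∣ℕ-* m@(suc _) n@(suc _) =
    trans (cong p^- (ν-* m n)) (^-homo-* (ℚ.1/ (+ p ℚ./ 1)) (ν m) (ν n))

  ∣∣ℤ-mono : ∀ k i → p ℕ.^ k ℕ∣.∣ ℤ.∣ i ∣ → ∣ ℤ.∣ i ∣ ∣ℕ ℚ.≤ p^- k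
  ∣∣ℤ-mono k i d with ℤ.∣ i ∣
  ... | zero  = ℚ.<⇒≤ (ℚ.positive⁻¹ _ {{p^-pos k}})
  ... | suc n = p^-anti (≤ν (suc n) k d)

  ∣+∣ : ∀ {k} i j → p ℕ.^ k ℕ∣.∣ ℤ.∣ i ∣ → p ℕ.^ k ℕ∣.∣ ℤ.∣ j ∣ → p ℕ.^ k ℕ∣.∣ ℤ.∣ i ℤ.+ j ∣
  ∣+∣ {k} i j d e = ℤ∣.∣⇒∣ᵤ {+ (p ℕ.^ k)} (ℤ∣.∣m∣n⇒∣m+n
    (ℤ∣.∣ᵤ⇒∣ {+ (p ℕ.^ k)} {i} d) (ℤ∣.∣ᵤ⇒∣ {+ (p ℕ.^ k)} {j} e))

  ^∣^′ : ∀ {j k n} → j ℕ.≤ k → p ℕ.^ k ℕ∣.∣ n → p ℕ.^ j ℕ∣.∣ n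
  ^∣^′ {j} {k} j≤k = ℕ∣.∣-trans (subst (p ℕ.^ j ℕ∣.∣_)
      (trans (sym (ℕ.^-distribˡ-+-* p j (k ℕ.∸ j))) (cong (p ℕ.^_) (ℕ.m+[n∸m]≡n j≤k)))
      (ℕ∣.m∣m*n (p ℕ.^ (k ℕ.∸ j))))

  ∣∣ℤ-+ : ∀ i j → ∣ ℤ.∣ i ℤ.+ j ∣ ∣ℕ ℚ.≤ ∣ ℤ.∣ i ∣ ∣ℕ ℚ.+ ∣ ℤ.∣ j ∣ ∣ℕ
  ∣∣ℤ-+ i j with ℤ.∣ i ∣ in i≡ | ℤ.∣ j ∣ in j≡
  ... | zero | n = ℚ.≤-reflexive (trans
          (cong ∣_∣ℕ (trans (cong (λ t → ℤ.∣ t ℤ.+ j ∣) (ℤ.∣i∣≡0⇒i≡0 {i} i≡))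
            (trans (cong ℤ.∣_∣ (ℤ.+-identityˡ j)) j≡)))
          (sym (ℚ.+-identityˡ ∣ n ∣ℕ)))
  ... | m@(suc _) | zero = ℚ.≤-reflexive (trans
          (cong ∣_∣ℕ (trans (cong (λ t → ℤ.∣ i ℤ.+ t ∣) (ℤ.∣i∣≡0⇒i≡0 {j} j≡))
            (trans (cong ℤ.∣_∣ (ℤ.+-identityʳ i)) i≡)))
          (sym (ℚ.+-identityʳ ∣ m ∣ℕ)))
  ... | m@(suc _) | n@(suc _) with ℕ.≤-total (ν m) (ν n)
  ...   | inj₁ le = ℚ.≤-trans
            (∣∣ℤ-mono (ν m) (i ℤ.+ j) (∣+∣ {ν m} i j (subst (p ℕ.^ ν m ℕ∣.∣_) (sym i≡) (p^ν∣ m))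
              (^∣^′ {ν m} {ν n} le (subst (p ℕ.^ ν n ℕ∣.∣_) (sym j≡) (p^ν∣ n)))))
            (subst (ℚ._≤ ∣ m ∣ℕ ℚ.+ ∣ n ∣ℕ) (ℚ.+-identityʳ ∣ m ∣ℕ)
              (ℚ.+-monoʳ-≤ ∣ m ∣ℕ (0≤∣∣ℕ n)))
  ...   | inj₂ ge = ℚ.≤-trans
            (∣∣ℤ-mono (ν n) (i ℤ.+ j) (∣+∣ {ν n} i j
              (^∣^′ {ν n} {ν m} ge (subst (p ℕ.^ ν m ℕ∣.∣_) (sym i≡) (p^ν∣ m)))
              (subst (p ℕ.^ ν n ℕ∣.∣_) (sym j≡) (p^ν∣ n))))
            (subst (ℚ._≤ ∣ m ∣ℕ ℚ.+ ∣ n ∣ℕ) (ℚ.+-identityˡ ∣ n ∣ℕ)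
              (ℚ.+-monoˡ-≤ ∣ n ∣ℕ (0≤∣∣ℕ m)))

  ratio : ∀ x a b → ↥ x ℤ.* + b ≡ a ℤ.* ↧ x → ∣ x ∣ₚ ℚ.* ∣ b ∣ℕ ≡ ∣ ℤ.∣ a ∣ ∣ℕ
  ratio x@(mkℚ n d-1 _) a b eq = trans
      (solve 3 (λ n w b → (n :* w) :* b := (n :* b) :* w) refl ∣ ℤ.∣ n ∣ ∣ℕ (p^ (ν d)) ∣ b ∣ℕ)
      (trans (cong (ℚ._* p^ (ν d)) cross)
      (trans (solve 3 (λ a d w → (a :* d) :* w := a :* (w :* d)) refl ∣ ℤ.∣ a ∣ ∣ℕ ∣ d ∣ℕ (p^ (ν d)))
      (trans (cong (∣ ℤ.∣ a ∣ ∣ℕ ℚ.*_) (p^*p^- (ν d))) (ℚ.*-identityʳ _))))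
    where
    open +-*-Solver
    d : ℕ
    d = suc d-1
    cross : ∣ ℤ.∣ n ∣ ∣ℕ ℚ.* ∣ b ∣ℕ ≡ ∣ ℤ.∣ a ∣ ∣ℕ ℚ.* ∣ d ∣ℕ
    cross = trans (sym (∣∣ℕ-* ℤ.∣ n ∣ b)) (trans
      (cong ∣_∣ℕ (trans (sym (ℤ.abs-* n (+ b))) (trans (cong ℤ.∣_∣ eq) (ℤ.abs-* a (+ d)))))
      (∣∣ℕ-* ℤ.∣ a ∣ d))

  crossMultiply : ∀ z a b → ℚ.toℚᵘ z ℚᵘ.≃ ℚᵘ.mkℚᵘ a b → ↥ z ℤ.* + suc b ≡ a ℤ.* ↧ z
  crossMultiply record{} a b (ℚᵘ.*≡* eq) = eq

  den-pos : ∀ x y → ℚ.Positive ∣ ↧ₙ x ℕ.* ↧ₙ y ∣ℕ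
  den-pos x@record{} y@record{} = p^-pos (ν (↧ₙ x ℕ.* ↧ₙ y))

  cancel-≡ : ∀ r .{{_ : ℚ.Positive r}} {a b} → a ℚ.* r ≡ b ℚ.* r → a ≡ b
  cancel-≡ r eq = ℚ.≤-antisym (ℚ.*-cancelʳ-≤-pos r (ℚ.≤-reflexive eq))
                              (ℚ.*-cancelʳ-≤-pos r (ℚ.≤-reflexive (sym eq)))

  own : ∀ x → ∣ x ∣ₚ ℚ.* ∣ ↧ₙ x ∣ℕ ≡ ∣ ℤ.∣ ↥ x ∣ ∣ℕ
  own x@record{} = ratio x (↥ x) (↧ₙ x) refl

  ∣∣ₚ-* : ∀ x y → ∣ x ℚ.* y ∣ₚ ≡ ∣ x ∣ₚ ℚ.* ∣ y ∣ₚ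
  ∣∣ₚ-* x@record{} y@record{} = cancel-≡ ∣ dx ℕ.* dy ∣ℕ {{den-pos x y}} (trans
      (ratio (x ℚ.* y) (↥ x ℤ.* ↥ y) (dx ℕ.* dy) (crossMultiply (x ℚ.* y) _ _ (ℚ.toℚᵘ-homo-* x y)))
      (trans (cong ∣_∣ℕ (ℤ.abs-* (↥ x) (↥ y)))
      (trans (∣∣ℕ-* ℤ.∣ ↥ x ∣ ℤ.∣ ↥ y ∣)
      (trans (sym (cong₂ ℚ._*_ (own x) (own y)))
      (trans (solve 4 (λ a b c d → (a :* b) :* (c :* d) := (a :* c) :* (b :* d)) refl
               ∣ x ∣ₚ ∣ dx ∣ℕ ∣ y ∣ₚ ∣ dy ∣ℕ)
        (cong (∣ x ∣ₚ ℚ.* ∣ y ∣ₚ ℚ.*_) (sym (∣∣ℕ-* dx dy))))))))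
    where
    open +-*-Solver
    dx dy : ℕ
    dx = ↧ₙ x
    dy = ↧ₙ y

  ∣∣ₚ-+ : ∀ x y → ∣ x ℚ.+ y ∣ₚ ℚ.≤ ∣ x ∣ₚ ℚ.+ ∣ y ∣ₚ
  ∣∣ₚ-+ x@record{} y@record{} = ℚ.*-cancelʳ-≤-pos ∣ dx ℕ.* dy ∣ℕ {{den-pos x y}}
      (subst₂ ℚ._≤_
        (sym (ratio (x ℚ.+ y) (↥ x ℤ.* ↧ y ℤ.+ ↥ y ℤ.* ↧ x) (dx ℕ.* dy)
          (crossMultiply (x ℚ.+ y) _ _ (ℚ.toℚᵘ-homo-+ x y))))
        (trans (cong₂ ℚ._+_ (scale x dy) (scale y dx))
        (trans (solve 4 (λ a b c d → a :* b :* d :+ c :* d :* b := (a :+ c) :* (b :* d)) refl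
                 ∣ x ∣ₚ ∣ dx ∣ℕ ∣ y ∣ₚ ∣ dy ∣ℕ)
          (cong ((∣ x ∣ₚ ℚ.+ ∣ y ∣ₚ) ℚ.*_) (sym (∣∣ℕ-* dx dy)))))
        (∣∣ℤ-+ (↥ x ℤ.* ↧ y) (↥ y ℤ.* ↧ x)))
    where
    open +-*-Solver
    dx dy : ℕ
    dx = ↧ₙ x
    dy = ↧ₙ y
    scale : ∀ z d → ∣ ℤ.∣ ↥ z ℤ.* + d ∣ ∣ℕ ≡ ∣ z ∣ₚ ℚ.* ∣ ↧ₙ z ∣ℕ ℚ.* ∣ d ∣ℕ
    scale z d = trans (cong ∣_∣ℕ (ℤ.abs-* (↥ z) (+ d)))
      (trans (∣∣ℕ-* ℤ.∣ ↥ z ∣ d) (cong (ℚ._* ∣ d ∣ℕ) (sym (own z))))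

  ∣∣ₚ-neg : ∀ x → ∣ ℚ.- x ∣ₚ ≡ ∣ x ∣ₚ
  ∣∣ₚ-neg (mkℚ (+ zero)     _ _) = refl
  ∣∣ₚ-neg (mkℚ (+ suc _)    _ _) = refl
  ∣∣ₚ-neg (mkℚ (ℤ.-[1+ _ ]) _ _) = refl

  0≤∣∣ₚ : ∀ x → 0ℚ ℚ.≤ ∣ x ∣ₚ
  0≤∣∣ₚ x = ℚ.nonNegative⁻¹ _ {{ℚ.nonNeg*nonNeg⇒nonNeg
    ∣ ℤ.∣ ↥ x ∣ ∣ℕ {{ℚ.nonNegative (0≤∣∣ℕ ℤ.∣ ↥ x ∣)}}
    (p^ (ν (↧ₙ x))) {{ℚ.pos⇒nonNeg (p^ (ν (↧ₙ x))) {{^-pos (+ p ℚ./ 1) (ν (↧ₙ x))}}}}}}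

  ∣∣ₚ-definite : ∀ x → ∣ x ∣ₚ ≡ 0ℚ → x ≡ 0ℚ
  ∣∣ₚ-definite x ∣x∣≡0 = ℚ.↥p≡0⇒p≡0 x (ℤ.∣i∣≡0⇒i≡0 (vanish ℤ.∣ ↥ x ∣
      (trans (sym (own x)) (trans (cong (ℚ._* ∣ ↧ₙ x ∣ℕ) ∣x∣≡0) (ℚ.*-zeroˡ ∣ ↧ₙ x ∣ℕ)))))
    where
    vanish : ∀ n → ∣ n ∣ℕ ≡ 0ℚ → n ≡ 0
    vanish zero    _ = refl
    vanish (suc n) e = contradiction (sym e)
      (ℚ.<⇒≢ (ℚ.positive⁻¹ _ {{p^-pos (ν (suc n))}}))

  ∣∣ℕ≤1 : ∀ n → ∣ n ∣ℕ ℚ.≤ 1ℚ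
  ∣∣ℕ≤1 zero    = ℚ.nonNegative⁻¹ 1ℚ
  ∣∣ℕ≤1 (suc n) = p^-≤1 (ν (suc n))

  ∣n∣ₚ≡∣n∣ℕ : ∀ n → ∣ + n ℚ./ 1 ∣ₚ ≡ ∣ n ∣ℕ
  ∣n∣ₚ≡∣n∣ℕ n = cancel-≡ 1ℚ (trans
      (cong (∣ + n ℚ./ 1 ∣ₚ ℚ.*_) (sym ∣1∣))
      (trans (ratio (+ n ℚ./ 1) (+ n) 1 (crossMultiply (+ n ℚ./ 1) (+ n) 0 (ℚ.toℚᵘ-fromℚᵘ (ℚᵘ.mkℚᵘ (+ n) 0))))
        (sym (ℚ.*-identityʳ ∣ n ∣ℕ))))
    where
    ∣1∣ : ∣ 1 ∣ℕ ≡ 1ℚ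
    ∣1∣ = cong p^- (ℕ.n≤0⇒n≡0 (ℕ.≮⇒≥ λ lt → ℕ.<⇒≱ (ℕ.≤-<-trans lt (k<p^k (ν 1))) (ℕ∣.∣⇒≤ (p^ν∣ 1))))

  p-adic : AbsoluteValueℚ
  p-adic = record
    { ∣_∣      = ∣_∣ₚ
    ; 0≤∣∣     = 0≤∣∣ₚ
    ; ∣0∣      = ℚ.*-zeroˡ (p^ (ν 1))
    ; definite = ∣∣ₚ-definite
    ; ∣-∣      = ∣∣ₚ-neg
    ; ∣*∣      = ∣∣ₚ-*
    ; triangle = ∣∣ₚ-+
    }

  module Qp where
    open Completion p-adic public

    ∣_∣ : Carrier → ℝ
    ∣_∣ = extendedAbs p-adic

  ℚₚ : Set
  ℚₚ = Qp.Carrier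

  fromℕ : ℕ → ℚₚ
  fromℕ n = Qp.fromℚ (+ n ℚ./ 1)

  ℤₚ : Set
  ℤₚ = Σ ℚₚ λ x → Qp.∣ x ∣ Real.≤ Real.1ℝ

  infix 4 _≈ℤₚ_

  _≈ℤₚ_ : ℤₚ → ℤₚ → Set
  (x , _) ≈ℤₚ (y , _) = x Qp.≈ y

  dist : ℤₚ → ℤₚ → ℝ
  dist (x , _) (y , _) = Qp.∣ x Qp.+ (Qp.- y) ∣

  natural : ℕ → ℤₚ
  natural n = fromℕ n , λ ε 0<ε → 0 , λ _ _ → ℚ.≤-trans
    (subst (ℚ._≤ 1ℚ) (sym (∣n∣ₚ≡∣n∣ℕ n)) (∣∣ℕ≤1 n))
    (subst (ℚ._≤ 1ℚ ℚ.+ ε) (ℚ.+-identityʳ 1ℚ) (ℚ.+-monoʳ-≤ 1ℚ (ℚ.<⇒≤ 0<ε)))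

  -- A field extension of ℚₚ together with an absolute value extending ∣_∣ₚ.
  record ValuedExtension (ℓ : Level) : Set (lsuc ℓ) where
    field
      heytingField : HeytingField ℓ ℓ ℓ

    commutativeRing : CommutativeRing ℓ ℓ
    commutativeRing = HeytingCommutativeRing.commutativeRing (HeytingField.heytingCommutativeRing heytingField)

    open CommutativeRing commutativeRing public
      using (Carrier; _≈_; _+_; _*_; -_; _-_; 0#; 1#; setoid; rawRing; semiring; +-monoid)
    open MonoidSum +-monoid public using (sum)
    open SemiringExp semiring public using (_^_)

    field
      ι         : ℚₚ → Carrier
      ι-isRingHomomorphism :
        RingMorphisms.IsRingHomomorphism (CommutativeRing.rawRing Qp.commutativeRing) rawRing ι
      ∣_∣       : Carrier → ℝ
      ∣∣-cong   : ∀ {x y} → x ≈ y → ∣ x ∣ Real.≈ ∣ y ∣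
      0≤∣∣      : ∀ x → Real.0ℝ Real.≤ ∣ x ∣
      ∣0∣       : ∣ 0# ∣ Real.≈ Real.0ℝ
      definite  : ∀ x → ∣ x ∣ Real.≈ Real.0ℝ → x ≈ 0#
      ∣*∣       : ∀ x y → ∣ x * y ∣ Real.≈ ∣ x ∣ Real.* ∣ y ∣
      triangle  : ∀ x y → ∣ x + y ∣ Real.≤ ∣ x ∣ Real.+ ∣ y ∣
      extends   : ∀ x → ∣ ι x ∣ Real.≈ Qp.∣ x ∣

  record FiniteExtension (ℓ : Level) : Set (lsuc ℓ) where
    field
      valuedExtension : ValuedExtension ℓ

    open ValuedExtension valuedExtension public

    field
      size       : ℕ
      generator  : Fin size → Carrier
      spanning   : ∀ x → Σ (Fin size → ℚₚ) λ a →
                   x ≈ sum (λ i → ι (a i) * generator i)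

  -- Embeddings over ℚₚ.  Compatibility with absolute values only says that
  -- both sides carry "the" absolute value ∣_∣ₚ.
  record Embedding {ℓ : Level} (E F : ValuedExtension ℓ) : Set ℓ where
    private
      module E = ValuedExtension E
      module F = ValuedExtension F
    field
      ⟦_⟧                : E.Carrier → F.Carrier
      isRingHomomorphism : RingMorphisms.IsRingHomomorphism E.rawRing F.rawRing ⟦_⟧
      over-ℚₚ            : ∀ x → ⟦ E.ι x ⟧ F.≈ F.ι x
      isometric          : ∀ x → F.∣ ⟦ x ⟧ ∣ Real.≈ E.∣ x ∣

  record ContinuousMap {ℓ : Level} (E : ValuedExtension ℓ) : Set ℓ where
    open ValuedExtension E
    field
      to         : ℤₚ → Carrier
      to-cong    : ∀ x y → x ≈ℤₚ y → to x ≈ to y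
      continuous : ∀ x ε → Real.0ℝ Real.< ε →
                   Σ ℝ λ δ → Real.0ℝ Real.< δ ×
                     (∀ y → dist y x Real.< δ → ∣ to y - to x ∣ Real.< ε)

  -- x ∈ r + q ℤₚ
  InCoset : (r q : ℕ) → Pred ℤₚ 0ℓ
  InCoset r q (x , _) = Σ ℤₚ λ z → x Qp.≈ fromℕ r Qp.+ fromℕ q Qp.* proj₁ z

  infix 4 _DenseIn_

  _DenseIn_ : ∀ {ℓ : Level} → Pred ℕ ℓ → Pred ℤₚ 0ℓ → Set ℓ
  A DenseIn T =
    (∀ n → n ∈ A → natural n ∈ T) ×
    (∀ x → x ∈ T → ∀ ε → Real.0ℝ Real.< ε → ∃[ n ] n ∈ A × dist (natural n) x Real.< ε)

  record TwistedInterpolation {ℓ : Level} (K : FiniteExtension ℓ) (q : ℕ)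
                              (s : ℕ → FiniteExtension.Carrier K) : Set (lsuc ℓ) where
    field
      ∣J∣      : ℕ
      A        : Fin ∣J∣ → Pred ℕ ℓ
      covering : ∀ n → ∃[ j ] n ∈ A j
      disjoint : ∀ n i j → n ∈ A i → n ∈ A j → i ≡ j
      dense    : ∀ j → Σ ℕ λ r → r ℕ.< q × A j DenseIn InCoset r q
      L        : FiniteExtension ℓ
      -- The values s(n) ∈ K and s_j(n) ∈ L are compared in a common
      -- extension of K and L.
      Ω        : ValuedExtension ℓ
      K↪Ω      : Embedding (FiniteExtension.valuedExtension K) Ω
      L↪Ω      : Embedding (FiniteExtension.valuedExtension L) Ω
      interpolant : Fin ∣J∣ → ContinuousMap (FiniteExtension.valuedExtension L)
      agrees      : ∀ j n → n ∈ A j →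
        ValuedExtension._≈_ Ω (Embedding.⟦ K↪Ω ⟧ (s n))
          (Embedding.⟦ L↪Ω ⟧ (ContinuousMap.to (interpolant j) (natural n)))

{-# OPTIONS --safe #-}

-- Let n ∈ A_j.  Density of A_j in a coset of q ℤₚ containing n yields m ∈ A_j that are
-- arbitrarily close to n p-adically and at the same time arbitrarily large.  Along such m,
-- continuity at n gives s_j(m) → s_j(n) and bounds every c_β(m), so that s(m) → 0 because
-- ∣ β ∣ < 1.  As s(m) = s_j(m), it follows that s(n) = s_j(n) = 0.
module Submission where

open import Defs
open import Algebra.Bundles using (CommutativeRing)
import Algebra.Properties.Group as GroupProperties
import Algebra.Properties.Ring as RingProperties
import Algebra.Properties.Semiring.Exp as SemiringExp
open import Data.Fin.Base as Fin using (Fin)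
open import Data.Integer.Base as ℤ using (+_)
import Data.Integer.Properties as ℤ
open import Data.Nat.Base as ℕ using (ℕ; zero; suc)
import Data.Nat.Divisibility as ℕ∣
open import Data.Nat.Primality using (Prime; prime⇒nonZero; prime⇒nonTrivial)
import Data.Nat.Properties as ℕ
open import Data.Product.Base using (∃-syntax; _×_; _,_; proj₁; proj₂)
open import Data.Rational.Base as ℚ using (ℚ; 0ℚ; 1ℚ; ½; mkℚ)
import Data.Rational.Properties as ℚ
open import Data.Rational.Solver using (module +-*-Solver)
import Data.Rational.Unnormalised.Base as ℚᵘ
import Data.Rational.Unnormalised.Properties as ℚᵘ
open import Data.Sum.Base using (inj₁; inj₂; [_,_]′)
open import Function.Base using (id)
open import Function.Definitions using (Injective)
open import Level using (Level)
open import Relation.Binary.PropositionalEquality using (_≡_; refl; sym; trans; cong; cong₂; subst; subst₂)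
open import Relation.Nullary using (contradiction)
open import Relation.Unary using (Pred; _∈_)

open +-*-Solver
open SemiringExp (CommutativeRing.semiring ℚ.+-*-commutativeRing) using () renaming (_^_ to _^ℚ_)

-- Order and sign on the rationals.

½*ε<ε : ∀ {ε} → 0ℚ ℚ.< ε → ½ ℚ.* ε ℚ.< ε
½*ε<ε {ε} 0<ε = subst₂ ℚ._<_ (ℚ.+-identityʳ _) (Real.halves ε)
  (ℚ.+-monoʳ-< (½ ℚ.* ε) (Real.½*pos 0<ε))

*-pos : ∀ {x y} → 0ℚ ℚ.< x → 0ℚ ℚ.< y → 0ℚ ℚ.< x ℚ.* y
*-pos {x} {y} 0<x 0<y = ℚ.positive⁻¹ _
  {{ℚ.pos*pos⇒pos x {{ℚ.positive 0<x}} y {{ℚ.positive 0<y}}}}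

*-nonNeg : ∀ {x y} → 0ℚ ℚ.≤ x → 0ℚ ℚ.≤ y → 0ℚ ℚ.≤ x ℚ.* y
*-nonNeg {x} {y} 0≤x 0≤y = ℚ.nonNegative⁻¹ _
  {{ℚ.nonNeg*nonNeg⇒nonNeg x {{ℚ.nonNegative 0≤x}} y {{ℚ.nonNegative 0≤y}}}}

p<q⇒0<q-p : ∀ {x y} → x ℚ.< y → 0ℚ ℚ.< y ℚ.- x
p<q⇒0<q-p {x} {y} x<y = subst (ℚ._< y ℚ.- x) (ℚ.+-inverseʳ x) (ℚ.+-monoˡ-< (ℚ.- x) x<y)

∣p∣≤q : ∀ {x y} → x ℚ.≤ y → 0ℚ ℚ.≤ x ℚ.+ y → ℚ.∣ x ∣ ℚ.≤ y
∣p∣≤q {x} {y} x≤y 0≤x+y with ℚ.∣p∣≡p∨∣p∣≡-p x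
... | inj₁ e = subst (ℚ._≤ y) (sym e) x≤y
... | inj₂ e = subst₂ ℚ._≤_ (trans (ℚ.+-identityʳ (ℚ.- x)) (sym e))
  (solve 2 (λ x y → :- x :+ (x :+ y) := y) refl x y) (ℚ.+-monoʳ-≤ (ℚ.- x) 0≤x+y)

-- Natural numbers inside ℚ and the Archimedean property.

⟨_⟩ : ℕ → ℚ
⟨ n ⟩ = + n ℚ./ 1

toℚᵘ-⟨⟩ : ∀ n → ℚ.toℚᵘ ⟨ n ⟩ ℚᵘ.≃ ℚᵘ.mkℚᵘ (+ n) 0
toℚᵘ-⟨⟩ n = ℚ.toℚᵘ-fromℚᵘ (ℚᵘ.mkℚᵘ (+ n) 0)

⟨⟩-homo-+ : ∀ m n → ⟨ m ℕ.+ n ⟩ ≡ ⟨ m ⟩ ℚ.+ ⟨ n ⟩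
⟨⟩-homo-+ m n = ℚ.toℚᵘ-injective (ℚᵘ.≃-trans (toℚᵘ-⟨⟩ (m ℕ.+ n)) (ℚᵘ.≃-trans
  (ℚᵘ.*≡* (cong (ℤ._* + 1) (sym (cong₂ ℤ._+_ (ℤ.*-identityʳ (+ m)) (ℤ.*-identityʳ (+ n))))))
  (ℚᵘ.≃-sym (ℚᵘ.≃-trans (ℚ.toℚᵘ-homo-+ ⟨ m ⟩ ⟨ n ⟩) (ℚᵘ.+-cong (toℚᵘ-⟨⟩ m) (toℚᵘ-⟨⟩ n))))))

⟨⟩-homo-* : ∀ m n → ⟨ m ℕ.* n ⟩ ≡ ⟨ m ⟩ ℚ.* ⟨ n ⟩
⟨⟩-homo-* m n = ℚ.toℚᵘ-injective (ℚᵘ.≃-trans (toℚᵘ-⟨⟩ (m ℕ.* n)) (ℚᵘ.≃-trans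
  (ℚᵘ.*≡* (cong (ℤ._* + 1) (ℤ.pos-* m n)))
  (ℚᵘ.≃-sym (ℚᵘ.≃-trans (ℚ.toℚᵘ-homo-* ⟨ m ⟩ ⟨ n ⟩) (ℚᵘ.*-cong (toℚᵘ-⟨⟩ m) (toℚᵘ-⟨⟩ n))))))

⟨⟩-mono-≤ : ∀ {m n} → m ℕ.≤ n → ⟨ m ⟩ ℚ.≤ ⟨ n ⟩
⟨⟩-mono-≤ {m} {n} m≤n = ℚ.toℚᵘ-cancel-≤ (ℚᵘ.≤-trans (ℚᵘ.≤-reflexive (toℚᵘ-⟨⟩ m)) (ℚᵘ.≤-trans
  (ℚᵘ.*≤* (ℤ.*-monoʳ-≤-nonNeg (+ 1) (ℤ.+≤+ m≤n)))
  (ℚᵘ.≤-reflexive (ℚᵘ.≃-sym (toℚᵘ-⟨⟩ n)))))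

-- The absolute value of the numerator will do, as the denominator is at least 1.
archimedes : ∀ x → ∃[ n ] x ℚ.≤ ⟨ n ⟩
archimedes x@(mkℚ i d-1 _) = ℤ.∣ i ∣ , ℚ.toℚᵘ-cancel-≤ (ℚᵘ.≤-trans
  (ℚᵘ.*≤* (ℤ.≤-trans (ℤ.≤-reflexive (ℤ.*-identityʳ i)) (ℤ.≤-trans (i≤∣i∣ i)
    (subst (+ ℤ.∣ i ∣ ℤ.≤_) (ℤ.pos-* ℤ.∣ i ∣ (suc d-1)) (ℤ.+≤+ (ℕ.m≤m*n ℤ.∣ i ∣ (suc d-1)))))))
  (ℚᵘ.≤-reflexive (ℚᵘ.≃-sym (toℚᵘ-⟨⟩ ℤ.∣ i ∣))))
  where
  i≤∣i∣ : ∀ i → i ℤ.≤ + ℤ.∣ i ∣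
  i≤∣i∣ (+ n)      = ℤ.≤-refl
  i≤∣i∣ ℤ.-[1+ n ] = ℤ.-≤+

0≤⟨_⟩ : ∀ n → 0ℚ ℚ.≤ ⟨ n ⟩
0≤⟨ n ⟩ = ⟨⟩-mono-≤ {0} {n} ℕ.z≤n

-- Geometric sequences.

^-nonNeg : ∀ {ρ} → 0ℚ ℚ.≤ ρ → ∀ n → 0ℚ ℚ.≤ ρ ^ℚ n
^-nonNeg 0≤ρ zero    = ℚ.nonNegative⁻¹ 1ℚ
^-nonNeg 0≤ρ (suc n) = *-nonNeg 0≤ρ (^-nonNeg 0≤ρ n)

-- Bernoulli's inequality for 1 / ρ, free of division.
bernoulli : ∀ {ρ} → 0ℚ ℚ.≤ ρ → ρ ℚ.≤ 1ℚ → ∀ n → ρ ^ℚ n ℚ.* (1ℚ ℚ.+ ⟨ n ⟩ ℚ.* (1ℚ ℚ.- ρ)) ℚ.≤ 1ℚ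
bernoulli {ρ} 0≤ρ ρ≤1 zero = ℚ.≤-reflexive
  (solve 1 (λ ρ → con 1ℚ :* (con 1ℚ :+ con 0ℚ :* (con 1ℚ :- ρ)) := con 1ℚ) refl ρ)
bernoulli {ρ} 0≤ρ ρ≤1 (suc n) = ℚ.≤-trans step (bernoulli 0≤ρ ρ≤1 n)
  where
  ε a : ℚ
  ε = 1ℚ ℚ.- ρ
  a = 1ℚ ℚ.+ ⟨ n ⟩ ℚ.* ε
  0≤ε : 0ℚ ℚ.≤ ε
  0≤ε = subst (ℚ._≤ ε) (ℚ.+-inverseʳ ρ) (ℚ.+-monoˡ-≤ (ℚ.- ρ) ρ≤1)
  0≤[1+n]ε² : 0ℚ ℚ.≤ (1ℚ ℚ.+ ⟨ n ⟩) ℚ.* (ε ℚ.* ε)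
  0≤[1+n]ε² = *-nonNeg (ℚ.+-mono-≤ (ℚ.nonNegative⁻¹ 1ℚ) 0≤⟨ n ⟩) (*-nonNeg 0≤ε 0≤ε)
  -- As ρ = 1 - ε and (1 - ε)(1 + (n + 1) ε) = 1 + n ε - (n + 1) ε², the left side falls short of
  -- the right by ρ^n (n + 1) ε².
  step : ρ ^ℚ suc n ℚ.* (1ℚ ℚ.+ ⟨ suc n ⟩ ℚ.* ε) ℚ.≤ ρ ^ℚ n ℚ.* a
  step = subst₂ ℚ._≤_
    (trans (solve 3 (λ ρ r n →
        r :* (con 1ℚ :+ n :* (con 1ℚ :- ρ) :- (con 1ℚ :+ n) :* ((con 1ℚ :- ρ) :* (con 1ℚ :- ρ)))
        := ρ :* r :* (con 1ℚ :+ (con 1ℚ :+ n) :* (con 1ℚ :- ρ))) refl ρ (ρ ^ℚ n) ⟨ n ⟩)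
      (cong (λ t → ρ ℚ.* ρ ^ℚ n ℚ.* (1ℚ ℚ.+ t ℚ.* ε)) (sym (⟨⟩-homo-+ 1 n))))
    refl
    (ℚ.*-monoˡ-≤-nonNeg (ρ ^ℚ n) {{ℚ.nonNegative (^-nonNeg 0≤ρ n)}}
      (subst (a ℚ.- (1ℚ ℚ.+ ⟨ n ⟩) ℚ.* (ε ℚ.* ε) ℚ.≤_) (ℚ.+-identityʳ a)
        (ℚ.+-monoʳ-≤ a (ℚ.neg-antimono-≤ 0≤[1+n]ε²))))

-- With ε = 1 - ρ and N ≥ 1 / (η ε), every n ≥ N has η (1 + n ε) > 1, while Bernoulli gives ρ^n (1 +
-- n ε) ≤ 1. Cancelling the common factor yields ρ^n < η.
geometric→0 : ∀ {ρ} → 0ℚ ℚ.≤ ρ → ρ ℚ.< 1ℚ → ∀ {η} → 0ℚ ℚ.< η →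
              ∃[ N ] ∀ n → N ℕ.≤ n → ρ ^ℚ n ℚ.< η
geometric→0 {ρ} 0≤ρ ρ<1 {η} 0<η = N , λ n N≤n → ℚ.*-cancelʳ-<-nonNeg (a n) {{ℚ.nonNegative (0≤a n)}}
    (ℚ.≤-<-trans (bernoulli 0≤ρ (ℚ.<⇒≤ ρ<1) n) (ℚ.<-≤-trans large
      (ℚ.*-monoˡ-≤-nonNeg η {{ℚ.nonNegative (ℚ.<⇒≤ 0<η)}}
        (ℚ.+-monoʳ-≤ 1ℚ (ℚ.*-monoʳ-≤-nonNeg ε {{ℚ.nonNegative (ℚ.<⇒≤ 0<ε)}} (⟨⟩-mono-≤ N≤n))))))
  where
  ε : ℚ
  ε = 1ℚ ℚ.- ρ
  0<ε : 0ℚ ℚ.< ε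
  0<ε = p<q⇒0<q-p ρ<1
  instance
    posηε : ℚ.Positive (η ℚ.* ε)
    posηε = ℚ.positive (*-pos 0<η 0<ε)
    nzηε : ℚ.NonZero (η ℚ.* ε)
    nzηε = ℚ.pos⇒nonZero (η ℚ.* ε)
  N : ℕ
  N = proj₁ (archimedes (ℚ.1/ (η ℚ.* ε)))
  a : ℕ → ℚ
  a n = 1ℚ ℚ.+ ⟨ n ⟩ ℚ.* ε
  0≤a : ∀ n → 0ℚ ℚ.≤ a n
  0≤a n = ℚ.+-mono-≤ {0ℚ} {1ℚ} {0ℚ} (ℚ.nonNegative⁻¹ 1ℚ) (*-nonNeg 0≤⟨ n ⟩ (ℚ.<⇒≤ 0<ε))
  large : 1ℚ ℚ.< η ℚ.* a N
  large = ℚ.≤-<-trans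
    (subst (ℚ._≤ ⟨ N ⟩ ℚ.* (η ℚ.* ε)) (ℚ.*-inverseˡ (η ℚ.* ε))
      (ℚ.*-monoʳ-≤-nonNeg (η ℚ.* ε) {{ℚ.pos⇒nonNeg (η ℚ.* ε)}}
        (proj₂ (archimedes (ℚ.1/ (η ℚ.* ε))))))
    (subst₂ ℚ._<_ (ℚ.+-identityˡ _)
      (solve 3 (λ η n ε → η :+ n :* (η :* ε) := η :* (con 1ℚ :+ n :* ε)) refl η ⟨ N ⟩ ε)
      (ℚ.+-monoˡ-< (⟨ N ⟩ ℚ.* (η ℚ.* ε)) 0<η))

-- Rational bounds for real absolute values.

infix 4 _≺_

-- ∣ x ∣ < r, with a rational number strictly in between as witness.
record _≺_ (x : ℝ) (r : ℚ) : Set where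
  constructor bound
  field
    {r′}       : ℚ
    r′<r       : r′ ℚ.< r
    {N}        : ℕ
    eventually : ∀ n → N ℕ.≤ n → ℚ.∣ Real.seq x n ∣ ℚ.≤ r′

≺-mono : ∀ {x r s} → r ℚ.≤ s → x ≺ r → x ≺ s
≺-mono r≤s (bound r′<r e) = bound (ℚ.<-≤-trans r′<r r≤s) e

≺-bounded : ∀ x → ∃[ B ] 0ℚ ℚ.< B × x ≺ B
≺-bounded x =
  let B , 0<B , N , e = Real.bounded x
      B<B+1 = subst (ℚ._< B ℚ.+ 1ℚ) (ℚ.+-identityʳ B) (ℚ.+-monoʳ-< B (ℚ.positive⁻¹ 1ℚ))
  in B ℚ.+ 1ℚ , ℚ.<-trans 0<B B<B+1 , bound B<B+1 e

-- The witness bounds an absolute value, so it is nonnegative, and so is any `t` above it. This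
-- turns `∣ β ∣ < 1` into a rational ratio in [0, 1).
≺-dense : ∀ {x r} → x ≺ r → ∃[ t ] 0ℚ ℚ.≤ t × t ℚ.< r × x ≺ t
≺-dense (bound r′<r {N} e) =
  let t , r′<t , t<r = ℚ.<-dense r′<r
  in t , ℚ.<⇒≤ (ℚ.≤-<-trans (ℚ.≤-trans (ℚ.0≤∣p∣ _) (e N ℕ.≤-refl)) r′<t) , t<r , bound r′<t e

-- The gap between the witness and `r` absorbs the eventual difference of the two Cauchy sequences.
≺-cong : ∀ x y {r} → x Real.≈ y → y ≺ r → x ≺ r
≺-cong x y {r} x≈y (bound {r′} r′<r {N} e) =
  let t , r′<t , t<r = ℚ.<-dense r′<r
      M , f = x≈y (t ℚ.- r′) (p<q⇒0<q-p r′<t)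
  in bound t<r λ n N⊔M≤n → subst₂ ℚ._≤_
       (cong ℚ.∣_∣ (solve 2 (λ x y → (x :- y) :+ y := x) refl (Real.seq x n) (Real.seq y n)))
       (solve 2 (λ t r → (t :- r) :+ r := t) refl t r′)
       (ℚ.≤-trans (ℚ.∣p+q∣≤∣p∣+∣q∣ (Real.seq x n ℚ.- Real.seq y n) (Real.seq y n))
         (ℚ.+-mono-≤ (ℚ.<⇒≤ (f n (Real.⊔₂ {N} N⊔M≤n))) (e n (Real.⊔₁ {N} N⊔M≤n))))

-- A bound for `y` controls the terms of `x` from above, whereas `_≺_` concerns their absolute
-- values. Nonnegativity of `x` in ℝ makes its terms eventually at least `- t`, which is the other
-- side.
≺-≤ : ∀ x y {r} → Real.0ℝ Real.≤ x → x Real.≤ y → y ≺ r → x ≺ r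
≺-≤ x y {r} 0≤x x≤y (bound {r′} r′<r {N} e) =
  let t , r′<t , t<r = ℚ.<-dense r′<r
      0<t = ℚ.≤-<-trans (ℚ.≤-trans (ℚ.0≤∣p∣ _) (e N ℕ.≤-refl)) r′<t
      M , f = x≤y (t ℚ.- r′) (p<q⇒0<q-p r′<t)
      L , g = 0≤x t 0<t
  in bound t<r λ n le → ∣p∣≤q
       (ℚ.≤-trans (f n (Real.⊔₂ {N} (Real.⊔₁ le))) (subst (Real.seq y n ℚ.+ (t ℚ.- r′) ℚ.≤_)
          (solve 2 (λ t r → r :+ (t :- r) := t) refl t r′)
          (ℚ.+-monoˡ-≤ (t ℚ.- r′) (ℚ.≤-trans (p≤∣p∣ (Real.seq y n)) (e n (Real.⊔₁ {N} (Real.⊔₁ le)))))))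
       (g n (Real.⊔₂ {N ℕ.⊔ M} le))
  where
  p≤∣p∣ : ∀ a → a ℚ.≤ ℚ.∣ a ∣
  p≤∣p∣ a with ℚ.∣p∣≡p∨∣p∣≡-p a
  ... | inj₁ e = ℚ.≤-reflexive (sym e)
  ... | inj₂ e = ℚ.≤-trans (subst (ℚ._≤ 0ℚ) (trans (cong ℚ.-_ e) (solve 1 (λ a → :- (:- a) := a) refl a))
                   (ℚ.neg-antimono-≤ (ℚ.0≤∣p∣ a))) (ℚ.0≤∣p∣ a)

≺-+ : ∀ {x y r s} → x ≺ r → y ≺ s → (x Real.+ y) ≺ r ℚ.+ s
≺-+ {x} {y} (bound r′<r {N} e) (bound s′<s f) =
  bound (ℚ.+-mono-< r′<r s′<s) λ n le → ℚ.≤-trans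
    (ℚ.∣p+q∣≤∣p∣+∣q∣ (Real.seq x n) (Real.seq y n))
    (ℚ.+-mono-≤ (e n (Real.⊔₁ {N} le)) (f n (Real.⊔₂ {N} le)))

≺-* : ∀ {x y r s} → x ≺ r → y ≺ s → (x Real.* y) ≺ r ℚ.* s
≺-* {x} {y} {r} {s} (bound {r′} r′<r {N} e) (bound {s′} s′<s {M} f) =
  -- r′ s′ ≤ r′ s < r s, the last step being strict because s > s′ ≥ 0.
  bound (ℚ.≤-<-trans
      (ℚ.*-monoˡ-≤-nonNeg r′ {{ℚ.nonNegative 0≤r′}} (ℚ.<⇒≤ s′<s))
      (ℚ.*-monoˡ-<-pos s {{ℚ.positive (ℚ.≤-<-trans 0≤s′ s′<s)}} r′<r))
    λ n le → subst (ℚ._≤ r′ ℚ.* s′) (sym (ℚ.∣p*q∣≡∣p∣*∣q∣ (Real.seq x n) (Real.seq y n)))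
      (ℚ.≤-trans
        (ℚ.*-monoʳ-≤-nonNeg ℚ.∣ Real.seq y n ∣ {{ℚ.∣-∣-nonNeg (Real.seq y n)}} (e n (Real.⊔₁ {N} le)))
        (ℚ.*-monoˡ-≤-nonNeg r′ {{ℚ.nonNegative 0≤r′}} (f n (Real.⊔₂ {N} le))))
  where
  0≤r′ : 0ℚ ℚ.≤ r′
  0≤r′ = ℚ.≤-trans (ℚ.0≤∣p∣ _) (e N ℕ.≤-refl)
  0≤s′ : 0ℚ ℚ.≤ s′
  0≤s′ = ℚ.≤-trans (ℚ.0≤∣p∣ _) (f M ℕ.≤-refl)

<⇒≺ : ∀ x {r} → 0ℚ ℚ.< r → Real.0ℝ Real.≤ x → x Real.< Real.fromℚ r → x ≺ r
<⇒≺ x {r} 0<r 0≤x (ε , 0<ε , N , e) with ℚ.<-dense 0<r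
... | t , 0<t , t<r =
  let M , f = 0≤x t 0<t
      s = r ℚ.- ε
      -- `s` bounds the terms from above but may be negative; `t` is positive and bounds them from
      -- below by `- t`. Their maximum does both.
      u = s ℚ.⊔ t
      s<r = subst (s ℚ.<_) (ℚ.+-identityʳ r) (ℚ.+-monoʳ-< r (ℚ.neg-antimono-< 0<ε))
  in bound (⊔-< s<r t<r) λ n le → ∣p∣≤q
       (ℚ.≤-trans (subst (ℚ._≤ s) (solve 2 (λ x ε → (x :+ ε) :- ε := x) refl (Real.seq x n) ε)
           (ℚ.+-monoˡ-≤ (ℚ.- ε) (e n (Real.⊔₁ {N} le))))
         (ℚ.p≤p⊔q s t))
       (ℚ.≤-trans (f n (Real.⊔₂ {N} le)) (ℚ.+-monoʳ-≤ (Real.seq x n) (ℚ.p≤q⊔p s t)))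
  where
  ⊔-< : ∀ {a b c} → a ℚ.< c → b ℚ.< c → a ℚ.⊔ b ℚ.< c
  ⊔-< {a} {b} a<c b<c with ℚ.⊔-sel a b
  ... | inj₁ e = subst (ℚ._< _) (sym e) a<c
  ... | inj₂ e = subst (ℚ._< _) (sym e) b<c

≺-all⇒≈0 : ∀ x → (∀ r → 0ℚ ℚ.< r → x ≺ r) → x Real.≈ Real.0ℝ
≺-all⇒≈0 x h ε 0<ε with h ε 0<ε
... | bound r′<r {N} e = N , λ n le → ℚ.≤-<-trans
  (subst (ℚ._≤ _) (cong ℚ.∣_∣ (sym (ℚ.+-identityʳ (Real.seq x n)))) (e n le)) r′<r

-- p-adic distance and congruence of natural numbers.

module _ {p : ℕ} {p-prime : Prime p} where
  open PAdic p p-prime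

  private
    instance
      p≢0 : ℕ.NonZero p
      p≢0 = prime⇒nonZero p-prime
      P≢0 : ℚ.NonZero ⟨ p ⟩
      P≢0 = ℚ.pos⇒nonZero ⟨ p ⟩ {{ℚ.normalize-pos p 1}}

  0<p^- : ∀ k → 0ℚ ℚ.< p^- k
  0<p^- k = ℚ.positive⁻¹ _ {{p^-pos k}}

  -- This is 2 ≤ p. The factor 2 leaves room for error terms when a p-adic bound is turned into
  -- divisibility.
  p^-double : ∀ k → p^- (suc k) ℚ.+ p^- (suc k) ℚ.≤ p^- k
  p^-double k = subst₂ ℚ._≤_
    (solve 1 (λ u → con ⟨ 2 ⟩ :* u := u :+ u) refl (p^- (suc k)))
    (trans (sym (ℚ.*-assoc ⟨ p ⟩ (ℚ.1/ ⟨ p ⟩) (p^- k)))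
      (trans (cong (ℚ._* p^- k) (ℚ.*-inverseʳ ⟨ p ⟩)) (ℚ.*-identityˡ (p^- k))))
    (ℚ.*-monoʳ-≤-nonNeg (p^- (suc k)) {{ℚ.nonNegative (ℚ.<⇒≤ (0<p^- (suc k)))}}
      (⟨⟩-mono-≤ (ℕ.nonTrivial⇒n>1 p {{prime⇒nonTrivial p-prime}})))

  p^-→0 : ∀ {η} → 0ℚ ℚ.< η → ∃[ k ] p^- k ℚ.< η
  p^-→0 0<η =
    let N , small = geometric→0 0≤P⁻¹ P⁻¹<1 0<η in N , small N ℕ.≤-refl
    where
    0≤P⁻¹ : 0ℚ ℚ.≤ ℚ.1/ ⟨ p ⟩
    0≤P⁻¹ = subst (0ℚ ℚ.≤_) (ℚ.*-identityʳ (ℚ.1/ ⟨ p ⟩)) (ℚ.<⇒≤ (0<p^- 1))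
    P⁻¹<1 : ℚ.1/ ⟨ p ⟩ ℚ.< 1ℚ
    P⁻¹<1 = subst (ℚ._< 1ℚ) (ℚ.*-identityʳ (ℚ.1/ ⟨ p ⟩)) (ℚ.<-≤-trans
      (subst (ℚ._< p^- 1 ℚ.+ p^- 1) (ℚ.+-identityʳ (p^- 1)) (ℚ.+-monoʳ-< (p^- 1) (0<p^- 1)))
      (p^-double 0))

  -- ∣_∣ℕ takes no value strictly between p ^ (- k) and p ^ (1 - k), and 2 ≤ p.
  ∣∣ℕ<2p^-⇒∣ : ∀ k d → ∣ d ∣ℕ ℚ.< p^- k ℚ.+ p^- k → p ℕ.^ k ℕ∣.∣ d
  ∣∣ℕ<2p^-⇒∣ k zero    _ = (p ℕ.^ k) ℕ∣.∣0
  ∣∣ℕ<2p^-⇒∣ k (suc d) lt = [ k≤ν⇒∣ , (λ ν<k → contradiction refl (ℚ.<⇒≢ (ν<k⇒< ν<k))) ]′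
      (ℕ.≤-<-connex k (ν (suc d)))
    where
    k≤ν⇒∣ : k ℕ.≤ ν (suc d) → p ℕ.^ k ℕ∣.∣ suc d
    k≤ν⇒∣ k≤ν = ^∣^′ {k} {ν (suc d)} k≤ν (p^ν∣ (suc d))
    ν<k⇒< : ν (suc d) ℕ.< k → p^- (ν (suc d)) ℚ.< p^- (ν (suc d))
    ν<k⇒< ν<k = ℚ.<-≤-trans lt (ℚ.≤-trans
      (ℚ.+-mono-≤ (p^-anti ν<k) (p^-anti ν<k)) (p^-double (ν (suc d))))

  ∣⟨n+d⟩-⟨n⟩∣ₚ : ∀ n d → ∣ ⟨ n ℕ.+ d ⟩ ℚ.- ⟨ n ⟩ ∣ₚ ≡ ∣ d ∣ℕ
  ∣⟨n+d⟩-⟨n⟩∣ₚ n d = trans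
    (cong ∣_∣ₚ (trans (cong (ℚ._- ⟨ n ⟩) (⟨⟩-homo-+ n d))
      (solve 2 (λ n d → (n :+ d) :- n := d) refl ⟨ n ⟩ ⟨ d ⟩)))
    (∣n∣ₚ≡∣n∣ℕ d)

  ∣⟨m⟩-⟨n⟩∣ₚ : ∀ m n → n ℕ.≤ m → ∣ ⟨ m ⟩ ℚ.- ⟨ n ⟩ ∣ₚ ≡ ∣ m ℕ.∸ n ∣ℕ
  ∣⟨m⟩-⟨n⟩∣ₚ m n n≤m = trans
    (cong (λ m → ∣ ⟨ m ⟩ ℚ.- ⟨ n ⟩ ∣ₚ) (sym (ℕ.m+[n∸m]≡n n≤m)))
    (∣⟨n+d⟩-⟨n⟩∣ₚ n (m ℕ.∸ n))

  -- The bound makes p^k divide the difference. If m ≤ n, then n - m ≤ n < p^k forces n - m = 0;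
  -- hence m is never below n, and closeness to n also makes m large.
  near⇒congruent : ∀ k m n → n ℕ.< p ℕ.^ k → ∣ ⟨ m ⟩ ℚ.- ⟨ n ⟩ ∣ₚ ℚ.< p^- k ℚ.+ p^- k →
                   ∃[ d ] p ℕ.^ k ℕ∣.∣ d × m ≡ n ℕ.+ d
  near⇒congruent k m n n<p^k lt =
      m ℕ.∸ n
    , ∣∣ℕ<2p^-⇒∣ k (m ℕ.∸ n) (subst (ℚ._< p^- k ℚ.+ p^- k) (∣⟨m⟩-⟨n⟩∣ₚ m n n≤m) lt)
    , sym (ℕ.m+[n∸m]≡n n≤m)
    where
    ∣∧<⇒≡0 : ∀ {q d} → q ℕ∣.∣ d → d ℕ.< q → d ≡ 0
    ∣∧<⇒≡0 {d = zero}  _   _   = refl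
    ∣∧<⇒≡0 {d = suc _} q∣d d<q = contradiction (ℕ∣.∣⇒≤ q∣d) (ℕ.<⇒≱ d<q)
    m≤n⇒n≤m : m ℕ.≤ n → n ℕ.≤ m
    m≤n⇒n≤m m≤n = ℕ.m∸n≡0⇒m≤n (∣∧<⇒≡0
      (∣∣ℕ<2p^-⇒∣ k (n ℕ.∸ m) (subst (ℚ._< p^- k ℚ.+ p^- k)
        (trans (Qp.∣∣-comm ⟨ m ⟩ ⟨ n ⟩) (∣⟨m⟩-⟨n⟩∣ₚ n m m≤n)) lt))
      (ℕ.≤-<-trans (ℕ.m∸n≤m n m) n<p^k))
    n≤m : n ℕ.≤ m
    n≤m = [ id , m≤n⇒n≤m ]′ (ℕ.≤-total n m)

  -- The p-adic integer `z` is replaced by a late rational term `ζ` of its Cauchy sequence, which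
  -- reduces the claim to `near⇒congruent`.
  InCoset⇒congruent : ∀ e r n → r ℕ.< p ℕ.^ e → natural n ∈ InCoset r (p ℕ.^ e) →
                      ∃[ t ] n ≡ r ℕ.+ p ℕ.^ e ℕ.* t
  InCoset⇒congruent e r n r<p^e ((z , ∣z∣≤1) , n≈r+qz) =
    -- Half of p^(-e) for the approximation and 1 + ½ times p^(-e) for q ζ add up to exactly twice
    -- p^(-e), the bound that `near⇒congruent` accepts.
    let ε = ½ ℚ.* p^- e
        0<ε = Real.½*pos (0<p^- e)
        N , close = n≈r+qz ε 0<ε
        M , integral = ∣z∣≤1 ½ (ℚ.positive⁻¹ ½)
        i = N ℕ.⊔ M
        ζ = Qp.seq z i
        split : (⟨ n ⟩ ℚ.- (⟨ r ⟩ ℚ.+ ⟨ p ℕ.^ e ⟩ ℚ.* ζ)) ℚ.+ ⟨ p ℕ.^ e ⟩ ℚ.* ζ ≡ ⟨ n ⟩ ℚ.- ⟨ r ⟩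
        split = solve 4 (λ n r q z → (n :- (r :+ q :* z)) :+ q :* z := n :- r) refl
                  ⟨ n ⟩ ⟨ r ⟩ ⟨ p ℕ.^ e ⟩ ζ
        ∣qζ∣≤ : ∣ ⟨ p ℕ.^ e ⟩ ℚ.* ζ ∣ₚ ℚ.≤ p^- e ℚ.* (1ℚ ℚ.+ ½)
        ∣qζ∣≤ = subst (ℚ._≤ p^- e ℚ.* (1ℚ ℚ.+ ½)) (sym (∣∣ₚ-* ⟨ p ℕ.^ e ⟩ ζ)) (ℚ.≤-trans
          (ℚ.*-monoʳ-≤-nonNeg ∣ ζ ∣ₚ {{ℚ.nonNegative (0≤∣∣ₚ ζ)}}
            (subst (ℚ._≤ p^- e) (sym (∣n∣ₚ≡∣n∣ℕ (p ℕ.^ e))) (∣∣ℤ-mono e (+ (p ℕ.^ e)) ℕ∣.∣-refl)))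
          (ℚ.*-monoˡ-≤-nonNeg (p^- e) {{ℚ.nonNegative (ℚ.<⇒≤ (0<p^- e))}}
            (integral i (ℕ.m≤n⊔m N M))))
        lt : ∣ ⟨ n ⟩ ℚ.- ⟨ r ⟩ ∣ₚ ℚ.< p^- e ℚ.+ p^- e
        lt = subst₂ ℚ._<_ (cong ∣_∣ₚ split)
          (solve 1 (λ u → con ½ :* u :+ u :* (con 1ℚ :+ con ½) := u :+ u) refl (p^- e))
          (ℚ.≤-<-trans (∣∣ₚ-+ (⟨ n ⟩ ℚ.- (⟨ r ⟩ ℚ.+ ⟨ p ℕ.^ e ⟩ ℚ.* ζ)) (⟨ p ℕ.^ e ⟩ ℚ.* ζ)) (ℚ.+-mono-<-≤ (close i (ℕ.m≤m⊔n N M)) ∣qζ∣≤))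
        d , ℕ∣.divides t d≡t*q , n≡r+d = near⇒congruent e n r r<p^e lt
    in t , trans n≡r+d (cong (r ℕ.+_) (trans d≡t*q (ℕ.*-comm t (p ℕ.^ e))))

  -- Points of a dense set that are both close to n and large.

  -- The filter of neighbourhoods of (n , ∞) in ℤₚ × (ℕ ∪ {∞}), traced on the diagonal ℕ.
  record Near {a} (n : ℕ) (P : Pred ℕ a) : Set a where
    constructor near
    field
      k     : ℕ
      holds : ∀ m → k ℕ.≤ m → ∣ ⟨ m ⟩ ℚ.- ⟨ n ⟩ ∣ₚ ℚ.≤ p^- k → P m

  Near-map₂ : ∀ {a b c n} {P : Pred ℕ a} {Q : Pred ℕ b} {R : Pred ℕ c} →
              (∀ m → P m → Q m → R m) → Near n P → Near n Q → Near n R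
  Near-map₂ f (near k P) (near l Q) = near (k ℕ.⊔ l) λ m k⊔l≤m close → f m
    (P m (ℕ.m⊔n≤o⇒m≤o k l k⊔l≤m) (ℚ.≤-trans close (p^-anti (ℕ.m≤m⊔n k l))))
    (Q m (ℕ.m⊔n≤o⇒n≤o k l k⊔l≤m) (ℚ.≤-trans close (p^-anti (ℕ.m≤n⊔m k l))))

  -- Approximating n itself might return n. The target is instead a natural number x ≥ k of the same
  -- coset with p^k dividing x - n, and it is approximated so finely that the point found is x plus
  -- a multiple of p^x.
  dense⇒Near-meets : ∀ {a b} {A : Pred ℕ a} {P : Pred ℕ b} e r → r ℕ.< p ℕ.^ e →
                     A DenseIn InCoset r (p ℕ.^ e) →
                     ∀ n → n ∈ A → Near n P → ∃[ m ] m ∈ A × P m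
  dense⇒Near-meets {A = A} e r r<q (A⊆coset , dense) n n∈A (near k P) =
    let m , m∈A , m≈x = approximation
        k≤m , close = far∧close m (near⇒congruent x m x (k<p^k x) (∣m-x∣<2p^-x m m≈x))
    in m , m∈A , P m k≤m close
    where
    q t x : ℕ
    q = p ℕ.^ e
    t = proj₁ (InCoset⇒congruent e r n r<q (A⊆coset n n∈A))
    -- As n = r + q t, this is n + q p^k.
    x = r ℕ.+ q ℕ.* (t ℕ.+ p ℕ.^ k)

    x∈coset : natural x ∈ InCoset r q
    x∈coset = natural (t ℕ.+ p ℕ.^ k) , Qp.pointwise
      {fromℕ x} {fromℕ r Qp.+ fromℕ q Qp.* fromℕ (t ℕ.+ p ℕ.^ k)}
      λ _ → trans (⟨⟩-homo-+ r (q ℕ.* (t ℕ.+ p ℕ.^ k)))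
              (cong (⟨ r ⟩ ℚ.+_) (⟨⟩-homo-* q (t ℕ.+ p ℕ.^ k)))

    approximation : ∃[ m ] m ∈ A × dist (natural m) (natural x) Real.< Real.fromℚ (p^- x)
    -- The exponent x serves as its own precision: x < p^x is what `near⇒congruent` requires.
    approximation = dense (natural x) x∈coset (Real.fromℚ (p^- x))
      (p^- x , 0<p^- x , 0 , λ _ _ → ℚ.≤-reflexive (ℚ.+-identityˡ (p^- x)))

    ∣m-x∣<2p^-x : ∀ m → dist (natural m) (natural x) Real.< Real.fromℚ (p^- x) →
                  ∣ ⟨ m ⟩ ℚ.- ⟨ x ⟩ ∣ₚ ℚ.< p^- x ℚ.+ p^- x
    ∣m-x∣<2p^-x m (ε , 0<ε , N , ∣m-x∣+ε≤p^-x) = ℚ.<-≤-trans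
      (subst (ℚ._< ∣ ⟨ m ⟩ ℚ.- ⟨ x ⟩ ∣ₚ ℚ.+ ε) (ℚ.+-identityʳ ∣ ⟨ m ⟩ ℚ.- ⟨ x ⟩ ∣ₚ)
        (ℚ.+-monoʳ-< ∣ ⟨ m ⟩ ℚ.- ⟨ x ⟩ ∣ₚ 0<ε))
      (ℚ.≤-trans (∣m-x∣+ε≤p^-x N ℕ.≤-refl)
        (subst (ℚ._≤ p^- x ℚ.+ p^- x) (ℚ.+-identityʳ (p^- x)) (ℚ.+-monoʳ-≤ (p^- x) (ℚ.<⇒≤ (0<p^- x)))))

    k≤x : k ℕ.≤ x
    k≤x = ℕ.≤-trans (ℕ.<⇒≤ (k<p^k k)) (ℕ.≤-trans (ℕ.m≤n+m (p ℕ.^ k) t)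
      (ℕ.≤-trans (ℕ.m≤n*m (t ℕ.+ p ℕ.^ k) q {{ℕ.m^n≢0 p e}}) (ℕ.m≤n+m _ r)))

    x≡n+qp^k : x ≡ n ℕ.+ q ℕ.* p ℕ.^ k
    x≡n+qp^k = trans (cong (r ℕ.+_) (ℕ.*-distribˡ-+ q t (p ℕ.^ k)))
      (trans (sym (ℕ.+-assoc r (q ℕ.* t) (q ℕ.* p ℕ.^ k)))
        (cong (ℕ._+ q ℕ.* p ℕ.^ k) (sym (proj₂ (InCoset⇒congruent e r n r<q (A⊆coset n n∈A))))))

    far∧close : ∀ m → ∃[ d ] p ℕ.^ x ℕ∣.∣ d × m ≡ x ℕ.+ d →
                k ℕ.≤ m × ∣ ⟨ m ⟩ ℚ.- ⟨ n ⟩ ∣ₚ ℚ.≤ p^- k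
    far∧close m (d , p^x∣d , m≡x+d) =
        subst (k ℕ.≤_) (sym m≡x+d) (ℕ.≤-trans k≤x (ℕ.m≤m+n x d))
      , subst (ℚ._≤ p^- k)
          (sym (trans (cong (λ m → ∣ ⟨ m ⟩ ℚ.- ⟨ n ⟩ ∣ₚ) m≡n+D) (∣⟨n+d⟩-⟨n⟩∣ₚ n D)))
          -- p^k divides both summands of `D`, the second because k ≤ x.
          (∣∣ℤ-mono k (+ D) (ℕ∣.∣m∣n⇒∣m+n (ℕ∣.n∣m*n q) (^∣^′ {k} {x} k≤x p^x∣d)))
      where
      D : ℕ
      D = q ℕ.* p ℕ.^ k ℕ.+ d
      m≡n+D : m ≡ n ℕ.+ D
      m≡n+D = trans m≡x+d (trans (cong (ℕ._+ d) x≡n+qp^k) (ℕ.+-assoc n (q ℕ.* p ℕ.^ k) d))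

  -- Bounds and null functions in a valued extension.

  module _ {ℓ : Level} (E : ValuedExtension ℓ) where
    open ValuedExtension E
    open CommutativeRing commutativeRing
      using (ring; +-group; +-congʳ) renaming (sym to ≈-sym; trans to ≈-trans)

    ∣∣≺-cong : ∀ {x y r} → x ≈ y → ∣ x ∣ ≺ r → ∣ y ∣ ≺ r
    ∣∣≺-cong {x} {y} x≈y = ≺-cong ∣ y ∣ ∣ x ∣ (∣∣-cong (≈-sym x≈y))

    ∣∣≺-+ : ∀ {x y r s} → ∣ x ∣ ≺ r → ∣ y ∣ ≺ s → ∣ x + y ∣ ≺ r ℚ.+ s
    ∣∣≺-+ {x} {y} x≺r y≺s =
      ≺-≤ ∣ x + y ∣ (∣ x ∣ Real.+ ∣ y ∣) (0≤∣∣ (x + y)) (triangle x y)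
        (≺-+ {∣ x ∣} {∣ y ∣} x≺r y≺s)

    ∣∣≺-* : ∀ {x y r s} → ∣ x ∣ ≺ r → ∣ y ∣ ≺ s → ∣ x * y ∣ ≺ r ℚ.* s
    ∣∣≺-* {x} {y} x≺r y≺s = ≺-cong ∣ x * y ∣ (∣ x ∣ Real.* ∣ y ∣) (∣*∣ x y)
      (≺-* {∣ x ∣} {∣ y ∣} x≺r y≺s)

    -- `C` accounts for the empty product at the start of the induction; a constant factor is
    -- harmless against ρ^n.
    ∣∣≺-^ : ∀ {x C ρ} → ∣ 1# ∣ ≺ C → ∣ x ∣ ≺ ρ → ∀ n → ∣ x ^ n ∣ ≺ ρ ^ℚ n ℚ.* C
    ∣∣≺-^ {C = C} 1≺C x≺ρ zero = subst (_ ≺_) (sym (ℚ.*-identityˡ C)) 1≺C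
    ∣∣≺-^ {C = C} {ρ} 1≺C x≺ρ (suc n) = subst (_ ≺_) (sym (ℚ.*-assoc ρ (ρ ^ℚ n) C))
      (∣∣≺-* x≺ρ (∣∣≺-^ 1≺C x≺ρ n))

    x-y+y≈x : ∀ x y → (x - y) + y ≈ x
    x-y+y≈x x y = GroupProperties.//-rightDividesˡ +-group y x

    -- ∣ - x ∣ ≈ ∣ x ∣ is not an axiom of ValuedExtension; a bound for ∣ - 1 ∣ does instead.
    ∣∣≺-flip : ∀ {x y C r} → ∣ - 1# ∣ ≺ C → ∣ x - y ∣ ≺ r → ∣ y - x ∣ ≺ C ℚ.* r
    ∣∣≺-flip {x} {y} -1≺C x-y≺r = ∣∣≺-cong
      (≈-trans (RingProperties.-1*x≈-x ring (x - y)) (GroupProperties.⁻¹-anti-homo-// +-group x y))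
      (∣∣≺-* -1≺C x-y≺r)

    Null : ℕ → (ℕ → Carrier) → Set
    Null n f = ∀ r → 0ℚ ℚ.< r → Near n (λ m → ∣ f m ∣ ≺ r)

    continuous⇒Null : (f : ContinuousMap E) → let open ContinuousMap f in
                      ∀ n → Null n (λ m → to (natural m) - to (natural n))
    continuous⇒Null f n r 0<r =
      let open ContinuousMap f
          δ , (η , 0<η , N , η≤δ) , cont = continuous (natural n) (Real.fromℚ r)
            (r , 0<r , 0 , λ _ _ → ℚ.≤-reflexive (ℚ.+-identityˡ r))
          -- One half of `η` bounds the distance; the other is the gap below `δ` that the strict
          -- order on ℝ asks for.
          k , p^-k<½η = p^-→0 (Real.½*pos 0<η)
      in near k λ m _ close →
           <⇒≺ ∣ to (natural m) - to (natural n) ∣ 0<r (0≤∣∣ (to (natural m) - to (natural n)))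
             (cont (natural m) (½ ℚ.* η , Real.½*pos 0<η , N , λ i N≤i → ℚ.≤-trans
               (ℚ.+-monoˡ-≤ (½ ℚ.* η) (ℚ.≤-trans close (ℚ.<⇒≤ p^-k<½η)))
               (subst (ℚ._≤ Real.seq δ i) (trans (ℚ.+-identityˡ η) (sym (Real.halves η))) (η≤δ i N≤i))))

    Null-+ : ∀ {n f g} → Null n f → Null n g → Null n (λ m → f m + g m)
    Null-+ f→0 g→0 r 0<r = Near-map₂
      (λ m f≺ g≺ → subst (_ ≺_) (Real.halves r) (∣∣≺-+ f≺ g≺))
      (f→0 (½ ℚ.* r) (Real.½*pos 0<r)) (g→0 (½ ℚ.* r) (Real.½*pos 0<r))

    Null-sum : ∀ {n b} (f : Fin b → ℕ → Carrier) → (∀ i → Null n (f i)) →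
               Null n (λ m → sum (λ i → f i m))
    Null-sum {b = zero} f f→0 r 0<r = near 0 λ m _ _ →
      ≺-cong ∣ 0# ∣ Real.0ℝ ∣0∣ (bound 0<r {0} (λ _ _ → ℚ.≤-refl))
    Null-sum {b = suc b} f f→0 = Null-+ (f→0 Fin.zero) (Null-sum (λ i → f (Fin.suc i)) (λ i → f→0 (Fin.suc i)))

    -- p-adic closeness of m to n keeps the values of f below 1 + D by continuity, while largeness
    -- of m makes ρ^m, and with it the power of `β`, as small as desired.
    continuous*power⇒Null : (f : ContinuousMap E) (β : Carrier) → ∣ β ∣ Real.< Real.1ℝ →
                            ∀ n → Null n (λ m → ContinuousMap.to f (natural m) * β ^ m)
    continuous*power⇒Null f β ∣β∣<1 n r 0<r =
      let ρ , 0≤ρ , ρ<1 , β≺ρ = ≺-dense (<⇒≺ ∣ β ∣ (ℚ.positive⁻¹ 1ℚ) (0≤∣∣ β) ∣β∣<1)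
          D , 0<D , f[n]≺D = ≺-bounded ∣ to (natural n) ∣
          C , 0<C , 1≺C = ≺-bounded ∣ 1# ∣
          A = (1ℚ ℚ.+ D) ℚ.* C
          0<A = *-pos (ℚ.+-mono-< {0ℚ} {1ℚ} {0ℚ} (ℚ.positive⁻¹ 1ℚ) 0<D) 0<C
          η , 0<η , Aη≡½r = Real.share r A 0<r 0<A
          M , ρ^m<η = geometric→0 0≤ρ ρ<1 0<η
          Aρ^m≤r : ∀ m → M ℕ.≤ m → (1ℚ ℚ.+ D) ℚ.* (ρ ^ℚ m ℚ.* C) ℚ.≤ r
          Aρ^m≤r m M≤m = subst (ℚ._≤ r)
            (solve 3 (λ d c u → d :* c :* u := d :* (u :* c)) refl (1ℚ ℚ.+ D) C (ρ ^ℚ m))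
            (ℚ.≤-trans
              (ℚ.*-monoˡ-≤-nonNeg A {{ℚ.nonNegative (ℚ.<⇒≤ 0<A)}} (ℚ.<⇒≤ (ρ^m<η m M≤m)))
              (ℚ.≤-trans (ℚ.≤-reflexive Aη≡½r) (ℚ.<⇒≤ (½*ε<ε 0<r))))
      in Near-map₂
           (λ m f[m]-f[n]≺1 M≤m → ≺-mono (Aρ^m≤r m M≤m)
             (∣∣≺-*
               (∣∣≺-cong (x-y+y≈x (to (natural m)) (to (natural n))) (∣∣≺-+ f[m]-f[n]≺1 f[n]≺D))
               (∣∣≺-^ {β} 1≺C β≺ρ m)))
           (continuous⇒Null f n 1ℚ (ℚ.positive⁻¹ 1ℚ))
           (near M λ m M≤m _ → M≤m)
      where open ContinuousMap f

-- Comparison of `K` with `L` and vanishing of `s`.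

theorem3p7 : ∀ {ℓ : Level} (p : ℕ) (p-prime : Prime p) →
    let open PAdic p p-prime in
    (K : FiniteExtension ℓ) →
    let open FiniteExtension K in
    (b : ℕ) → 0 ℕ.< b →
    (β : Fin b → Carrier) → Injective _≡_ _≈_ β →
    (∀ i → ∣ β i ∣ Real.< Real.1ℝ) →
    (c : Fin b → ContinuousMap valuedExtension) →
    let s : ℕ → Carrier
        s n = sum (λ i → ContinuousMap.to (c i) (natural n) * β i ^ n)
    in
    (q : ℕ) → (∃[ e ] q ≡ p ℕ.^ e) →
    TwistedInterpolation K q s →
    ∀ n → s n ≈ 0#
theorem3p7 p p-prime K b _ β _ ∣β∣<1 c .(p ℕ.^ e) (e , refl) T n =
  K.definite (s n) (≺-all⇒≈0 K.∣ s n ∣ s[n]≺)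
  where
  open PAdic p p-prime
  open TwistedInterpolation T hiding (L)
  module K = FiniteExtension K
  module L = FiniteExtension (TwistedInterpolation.L T)
  module Ω = ValuedExtension Ω
  module K↪Ω = Embedding K↪Ω
  module L↪Ω = Embedding L↪Ω

  j : Fin ∣J∣
  j = proj₁ (covering n)

  n∈A : n ∈ A j
  n∈A = proj₂ (covering n)

  s : ℕ → K.Carrier
  s n = K.sum (λ i → ContinuousMap.to (c i) (natural n) K.* β i K.^ n)

  g : ℕ → L.Carrier
  g n = ContinuousMap.to (interpolant j) (natural n)

  -- The two values live in different fields; as both embeddings into `Ω` are isometric, their
  -- absolute values can be compared in ℝ.
  ∣s∣≈∣g∣ : ∀ m → m ∈ A j → K.∣ s m ∣ Real.≈ L.∣ g m ∣
  ∣s∣≈∣g∣ m m∈A =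
    Real.≈-trans {K.∣ s m ∣} {Ω.∣ K↪Ω.⟦ s m ⟧ ∣} {L.∣ g m ∣}
      (Real.≈-sym {Ω.∣ K↪Ω.⟦ s m ⟧ ∣} {K.∣ s m ∣} (K↪Ω.isometric (s m)))
      (Real.≈-trans {Ω.∣ K↪Ω.⟦ s m ⟧ ∣} {Ω.∣ L↪Ω.⟦ g m ⟧ ∣} {L.∣ g m ∣}
        (Ω.∣∣-cong (agrees j m m∈A)) (L↪Ω.isometric (g m)))

  s[n]≺ : ∀ r → 0ℚ ℚ.< r → K.∣ s n ∣ ≺ r
  s[n]≺ r 0<r =
    let C , 0<C , -1≺C = ≺-bounded L.∣ L.- L.1# ∣
        -- Reversing the difference g(m) - g(n) costs the factor `C`, so `η` is chosen with C η = r
        -- / 2.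
        η , 0<η , Cη≡½r = Real.share r C 0<r 0<C
        t , t<q , A-dense = dense j
        s→0 = Null-sum K.valuedExtension _
          (λ i → continuous*power⇒Null K.valuedExtension (c i) (β i) (∣β∣<1 i) n)
        m , m∈A , g[m]-g[n]≺η , s[m]≺½r = dense⇒Near-meets e t t<q A-dense n n∈A
          (Near-map₂ (λ _ → _,_)
            (continuous⇒Null L.valuedExtension (interpolant j) n η 0<η)
            (s→0 (½ ℚ.* r) (Real.½*pos 0<r)))
        g[m]≺½r = ≺-cong L.∣ g m ∣ K.∣ s m ∣
          (Real.≈-sym {K.∣ s m ∣} {L.∣ g m ∣} (∣s∣≈∣g∣ m m∈A)) s[m]≺½r
        -- g(n) = (g(n) - g(m)) + g(m), where continuity bounds the first summand and the decay of
        -- s(m) the second.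
        g[n]≺ = ∣∣≺-cong L.valuedExtension (x-y+y≈x L.valuedExtension (g n) (g m))
          (∣∣≺-+ L.valuedExtension (∣∣≺-flip L.valuedExtension -1≺C g[m]-g[n]≺η) g[m]≺½r)
    in ≺-cong K.∣ s n ∣ L.∣ g n ∣ (∣s∣≈∣g∣ n n∈A)
         (subst (L.∣ g n ∣ ≺_) (trans (cong (ℚ._+ ½ ℚ.* r) Cη≡½r) (Real.halves r)) g[n]≺)
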